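{- Let $\alpha$ be an exponentially closed ordinal. The following are equivalent: (1) Every $x\subseteq\alpha$ that is $\alpha$-wITRM-computable without parameters is $\alpha$-wITRM-recognizable without parameters. (2) $0$ (i.e., $\emptyset\subseteq\alpha$) is $\alpha$-wITRM-recognizable without parameters. (3) Some $x\subseteq\alpha$ that is $\alpha$-wITRM-computable without parameters is $\alpha$-wITRM-recognizable without parameters. (4) $\alpha$ is wITRM-searchable without parameters.
   Context: An (infinite) ordinal $\alpha$ is exponentially closed if $\beta^{\gamma}<\alpha$ for all $\beta,\gamma<\alpha$ (ordinal exponentiation). Machines. An $\alpha$-register machine program is an ordinary register machine program: a finite list of numbered lines using finitely many registers, each register containing an ordinal $<\alpha$. Commands: increment a register by $1$; copy one register to another; jump to a given line if two register contents agree (otherwise go to the next line); oracle command: for an oracle $x\subseteq\alpha$, replace the content $\iota$ of register $j$ by $1$ if $\iota\in x$ and by $0$ otherwise. Computations run along the ordinals: at successor times the active command is carried out; at limit times the index of the active program line and each register content are the inferior limits of the sequences of their earlier values. If such an inferior limit of register contents equals $\alpha$ (overflow), the computation of an $\alpha$-wITRM is undefined. Inputs and parameters are written in the first registers, all other registers start with $0$. $P^{x}(\vec\xi)\downarrow=c$ means that $P$ with oracle $x$ and input $\vec\xi$ halts with $c$ in the output register. A set $x\subseteq\alpha$ is $\alpha$-wITRM-computable without parameters if there is an $\alpha$-wITRM-program $P$ such that $P(\iota,0)\downarrow=\chi_{x}(\iota)$ for all $\iota<\alpha$. It is $\alpha$-wITRM-recognizable without parameters if there is an $\alpha$-wITRM-program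 $P$ such that, for all $y\subseteq\alpha$, $P^{y}(0)$ is defined and halts with output $1$ if $y=x$ and with output $0$ if $y\neq x$. $\alpha$ is wITRM-searchable without parameters if there is a halting $\alpha$-wITRM-program $P$, run in the parameter $0$, such that the first register used by $P$ contains each element of $\alpha$ at least once before $P$ stops. -}

module Defs where

open import Level using (Level; 0ℓ) renaming (suc to lsuc)
open import Data.Fin.Base using (fromℕ<)
open import Data.List.Base using (List; []; _∷_; length; lookup)
open import Data.Nat.Base as ℕ using (ℕ; zero; suc)
open import Data.Product.Base using (_×_; Σ-syntax; ∃-syntax)
open import Data.Sum.Base using (_⊎_)
open import Function.Base using (_∘_)
open import Function.Bundles using (_↣_)
open import Induction.WellFounded using (WellFounded)
open import Relation.Binary.Core using (Rel)
open import Relation.Binary.Structures using (IsStrictTotalOrder)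
open import Relation.Binary.PropositionalEquality.Core using (_≡_; _≢_)
open import Relation.Nullary.Negation.Core using (¬_)
open import Relation.Unary using (Pred; _∈_; _∉_; _≐_)
open import Relation.Unary.Polymorphic using (∅)

-- An ordinal is a well-ordered type; its elements stand for the smaller
-- ordinals.

record Ordinal (ℓ : Level) : Set (lsuc ℓ) where
  infix 4 _<_ _≤_
  field
    Carrier            : Set ℓ
    _<_                : Rel Carrier ℓ
    isStrictTotalOrder : IsStrictTotalOrder _≡_ _<_
    wellFounded        : WellFounded _<_

  _≤_ : Rel Carrier ℓ
  a ≤ b = a < b ⊎ a ≡ b

  IsZero : Pred Carrier ℓ
  IsZero a = ∀ b → a ≤ b

  -- IsSuc a b : b = a + 1
  IsSuc : Rel Carrier ℓ
  IsSuc a b = a < b × (∀ c → a < c → b ≤ c)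

  IsOne : Pred Carrier ℓ
  IsOne b = ∃[ a ] IsZero a × IsSuc a b

  IsLimit : Pred Carrier ℓ
  IsLimit a = ¬ IsZero a × (∀ b → ¬ IsSuc b a)

module _ {a r : Level} {A : Set a} (_≤_ : Rel A r) where

  IsSup : {p : Level} → Pred A p → Pred A _
  IsSup P v = (∀ m → P m → m ≤ v) × (∀ w → (∀ m → P m → m ≤ w) → v ≤ w)

  module _ {ℓ : Level} (θ : Ordinal ℓ) (f : Ordinal.Carrier θ → A) where
    private module θ = Ordinal θ

    -- m = min { f t | s ≤ t < l }
    IsTailMin : (l s : θ.Carrier) → Pred A _
    IsTailMin l s m = (∃[ t ] s θ.≤ t × t θ.< l × f t ≡ m)
                    × (∀ t → s θ.≤ t → t θ.< l → m ≤ f t)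

    -- v = sup_{s < l} min_{s ≤ t < l} f t.  No v in A qualifies when the
    -- tail minima are unbounded in A.
    IsLiminf : (l : θ.Carrier) → Pred A _
    IsLiminf l = IsSup (λ m → ∃[ s ] s θ.< l × IsTailMin l s m)

module Arithmetic {ℓ : Level} (α : Ordinal ℓ) where
  open Ordinal α

  -- The graph, inside α, of the function g defined by transfinite recursion:
  -- Base (g 0), Next (g γ) (g (γ + 1)), and g γ = sup_{η < γ} g η at limits.
  data Iterate (Base : Pred Carrier ℓ) (Next : Rel Carrier ℓ) : Rel Carrier ℓ where
    at-zero  : ∀ {γ δ} → IsZero γ → Base δ → Iterate Base Next γ δ
    at-suc   : ∀ {γ γ′ δ δ′} → IsSuc γ γ′ → Iterate Base Next γ δ → Next δ δ′ →
               Iterate Base Next γ′ δ′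
    at-limit : ∀ {γ δ} → IsLimit γ → (g : Carrier → Carrier) →
               (∀ η → η < γ → Iterate Base Next η (g η)) →
               IsSup _≤_ (λ v → ∃[ η ] η < γ × v ≡ g η) δ →
               Iterate Base Next γ δ

  -- Add β γ δ : β + γ = δ, and similarly for β · γ and β ^ γ.
  Add Mul Exp : Carrier → Rel Carrier ℓ
  Add β = Iterate (_≡ β) IsSuc
  Mul β = Iterate IsZero (λ δ δ′ → Add δ β δ′)
  Exp β = Iterate IsOne (λ δ δ′ → Mul δ β δ′)

-- All intermediate values in the recursion for β ^ γ are bounded by β ^ γ or
-- by 1, so for infinite α the value β ^ γ lies below α iff Exp β γ δ holds
-- for some δ in α, provided this is asked for all β and γ.
ExponentiallyClosed : {ℓ : Level} → Pred (Ordinal ℓ) ℓ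
ExponentiallyClosed α = (ℕ ↣ Carrier) × (∀ β γ → ∃[ δ ] Exp β γ δ)
  where open Ordinal α
        open Arithmetic α

data Command : Set where
  increment : (j : ℕ) → Command
  copy      : (source target : ℕ) → Command
  jump-if-≡ : (i j line : ℕ) → Command
  oracle    : (j : ℕ) → Command

-- Registers are indexed by ℕ; a program mentions only finitely many of them,
-- and the others keep the content 0.
Program : Set
Program = List Command

module Machine {ℓ : Level} (α : Ordinal ℓ) where
  open Ordinal α

  Subset : Set (lsuc ℓ)
  Subset = Pred Carrier ℓ

  record Config : Set ℓ where
    field
      line : ℕ
      reg  : ℕ → Carrier
  open Config public

  -- IsChar x ι v : v = χₓ(ι)
  IsChar : Subset → Rel Carrier ℓ
  IsChar x ι v = (ι ∈ x × IsOne v) ⊎ (ι ∉ x × IsZero v)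

  OthersUnchanged : ℕ → Rel Config ℓ
  OthersUnchanged j c c′ = ∀ i → i ≢ j → reg c′ i ≡ reg c i

  Exec : Subset → Command → Rel Config ℓ
  Exec x (increment j) c c′ =
    line c′ ≡ suc (line c) × IsSuc (reg c j) (reg c′ j) × OthersUnchanged j c c′
  Exec x (copy i j) c c′ =
    line c′ ≡ suc (line c) × reg c′ j ≡ reg c i × OthersUnchanged j c c′
  Exec x (jump-if-≡ i j l) c c′ =
    ((reg c i ≡ reg c j × line c′ ≡ l) ⊎ (reg c i ≢ reg c j × line c′ ≡ suc (line c)))
    × (∀ k → reg c′ k ≡ reg c k)
  Exec x (oracle j) c c′ =
    line c′ ≡ suc (line c) × IsChar x (reg c j) (reg c′ j) × OthersUnchanged j c c′

  Step : Program → Subset → Rel Config ℓ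
  Step P x c c′ = Σ[ l< ∈ line c ℕ.< length P ] Exec x (lookup P (fromℕ< l<)) c c′

  -- A computation stops when there is no line with the active index.
  Halted : Program → Config → Set
  Halted P c = length P ℕ.≤ line c

  InitialRegs : List Carrier → Pred (ℕ → Carrier) ℓ
  InitialRegs []       r = ∀ i → IsZero (r i)
  InitialRegs (ξ ∷ ξs) r = r 0 ≡ ξ × InitialRegs ξs (r ∘ suc)

  -- The times of a halting computation form a successor ordinal, whose last
  -- element is the halting time.  On overflow at a limit time the liminf does
  -- not exist in α, so there is no such computation.
  record HaltingRun (P : Program) (x : Subset) (ξs : List Carrier) : Set (lsuc ℓ) where
    field
      time : Ordinal ℓ
    private module T = Ordinal time
    field
      conf         : T.Carrier → Config
      initial-line : ∀ t → T.IsZero t → line (conf t) ≡ 0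
      initial-regs : ∀ t → T.IsZero t → InitialRegs ξs (reg (conf t))
      successor    : ∀ s t → T.IsSuc s t → Step P x (conf s) (conf t)
      limit-line   : ∀ t → T.IsLimit t →
                     IsLiminf ℕ._≤_ time (line ∘ conf) t (line (conf t))
      limit-regs   : ∀ t → T.IsLimit t → ∀ j →
                     IsLiminf _≤_ time (λ s → reg (conf s) j) t (reg (conf t) j)
      end          : T.Carrier
      end-last     : ∀ t → t T.≤ end
      end-halted   : Halted P (conf end)

    output : Carrier
    output = reg (conf end) 0

  -- P^x(ξs)↓ = c
  _^_[_]↓=_ : Program → Subset → List Carrier → Carrier → Set (lsuc ℓ)
  P ^ x [ ξs ]↓= c = Σ[ ρ ∈ HaltingRun P x ξs ] HaltingRun.output ρ ≡ c

  -- Computations without an oracle are computations with oracle ∅.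

  Computable : Pred Subset (lsuc ℓ)
  Computable x = ∃[ P ] ∀ ι z → IsZero z →
    ∃[ c ] IsChar x ι c × P ^ ∅ [ ι ∷ z ∷ [] ]↓= c

  Recognizable : Pred Subset (lsuc ℓ)
  Recognizable x = ∃[ P ] ∀ y z → IsZero z →
    (y ≐ x → ∃[ c ] IsOne c × P ^ y [ z ∷ [] ]↓= c) ×
    (¬ (y ≐ x) → ∃[ c ] IsZero c × P ^ y [ z ∷ [] ]↓= c)

  Searchable : Set (lsuc ℓ)
  Searchable = ∃[ P ] ∀ z → IsZero z →
    Σ[ ρ ∈ HaltingRun P ∅ (z ∷ []) ]
      let open HaltingRun ρ in
      ∀ ι → ∃[ t ] Ordinal._<_ time t end × reg (conf t) 0 ≡ ι

{-# OPTIONS --safe #-}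
-- (3) ⇒ (4): a program recognizing x must query its oracle at every ι < α, as
-- otherwise flipping x at ι would not change its run on x; running it with the
-- queries answered by a program computing x, and displaying each query in the
-- first register, is a search. (4) ⇒ (1): run a search and compare the oracle
-- with a computation of x at each element that appears in the first register.
-- In both cases each command of a given program becomes a block that calls the
-- program computing x and afterwards clears its registers. The time of the new
-- run is the sum of the running times of the blocks, and its limits are
-- harmless since blocks keep the order of the lines, the registers of the given
-- program change at most once per block, and all others are 0 between blocks.
module Submission where

open import Defs
open import Level using (Level; _⊔_; lift; lower) renaming (suc to lsuc)
open import Axiom.ExcludedMiddle using (ExcludedMiddle)
open import Data.Empty.Polymorphic using (⊥)
open import Data.Fin.Base using (fromℕ<)
open import Data.List.Base using (List; []; _∷_; _++_; length; lookup; map)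
open import Data.List.Properties using (length-map; length-++)
open import Data.Nat.Base as ℕ using (ℕ; zero; suc)
import Data.Nat.Induction as ℕᵢ
import Data.Nat.Properties as ℕₚ
open import Data.Product.Base using (_×_; _,_; proj₁; proj₂; ∃-syntax; Σ-syntax)
open import Data.Sum.Base using (_⊎_; inj₁; inj₂)
open import Data.Unit.Polymorphic using (⊤; tt)
open import Function.Base using (_∘_; _on_)
open import Function.Bundles using (_⇔_; mk⇔; _↣_; module Injection)
open import Induction.WellFounded using (WellFounded; Acc; acc)
import Relation.Binary.Construct.On as On
open import Relation.Binary.Core using (Rel)
open import Relation.Binary.Definitions using (Transitive; Trichotomous; tri<; tri≈; tri>)
open import Relation.Binary.PropositionalEquality
open import Relation.Binary.Structures using (IsStrictTotalOrder)
open import Relation.Nullary using (Dec; yes; no; ¬_; contradiction; recompute)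
open import Relation.Nullary.Decidable using (decidable-stable; map′)
open import Relation.Unary using (Pred; _∈_; _∉_; _≐_)
open import Relation.Unary.Polymorphic using (U; ∅)

-- A `HaltingRun` brings its own well-ordered clock, so neither uniqueness of outputs nor
-- composition of runs comes for free. Uniqueness is what turns an unqueried element into two
-- contradictory verdicts; it is obtained by matching the times of two runs by order type.
-- Composition uses a lexicographic sum of clocks, one for each time of the simulated run. Each
-- summand has a last element, so a limit of the sum lies inside a summand or at the start of a
-- summand over a limit time. All blocks of a compiled program have the same length, so line `l` is
-- sent to a multiple of that length. This relabelling is monotone, and on natural numbers monotone
-- maps commute with the limes inferior. On `α` they need not, so register contents are never
-- recoded, only moved to other registers.

minimal : ∀ {a r ℓ} {A : Set a} {_<_ : Rel A r} → WellFounded _<_ →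
          ExcludedMiddle (a ⊔ r ⊔ ℓ) → (P : Pred A (a ⊔ r ⊔ ℓ)) →
          ∃[ a ] P a → ∃[ m ] P m × (∀ n → P n → ¬ n < m)
minimal {_<_ = _<_} wf em P (a , Pa) = go a (wf a) Pa
  where
  go : ∀ a → Acc _<_ a → P a → ∃[ m ] P m × (∀ n → P n → ¬ n < m)
  go a (acc rs) Pa with em {∃[ b ] b < a × P b}
  ... | yes (b , b<a , Pb) = go b (rs b<a) Pb
  ... | no ∄ = a , Pa , λ n Pn n<a → ∄ (n , n<a , Pn)

-- Zero, successors and limits in a well-order

module OrdinalProperties {ℓ : Level} (θ : Ordinal ℓ) where
  open Ordinal θ
  open IsStrictTotalOrder isStrictTotalOrder public
    using (compare) renaming (trans to <-trans)

  <-irrefl : ∀ {a} → ¬ a < a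
  <-irrefl = IsStrictTotalOrder.irrefl isStrictTotalOrder refl

  ≤-refl : ∀ {a} → a ≤ a
  ≤-refl = inj₂ refl

  <-≤-trans : ∀ {a b c} → a < b → b ≤ c → a < c
  <-≤-trans a<b (inj₁ b<c)  = <-trans a<b b<c
  <-≤-trans a<b (inj₂ refl) = a<b

  ≤-<-trans : ∀ {a b c} → a ≤ b → b < c → a < c
  ≤-<-trans (inj₁ a<b)  b<c = <-trans a<b b<c
  ≤-<-trans (inj₂ refl) b<c = b<c

  ≤-trans : ∀ {a b c} → a ≤ b → b ≤ c → a ≤ c
  ≤-trans (inj₁ a<b)  b≤c = inj₁ (<-≤-trans a<b b≤c)
  ≤-trans (inj₂ refl) b≤c = b≤c

  ≤-antisym : ∀ {a b} → a ≤ b → b ≤ a → a ≡ b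
  ≤-antisym (inj₁ a<b)  b≤a = contradiction (<-≤-trans a<b b≤a) <-irrefl
  ≤-antisym (inj₂ a≡b)  b≤a = a≡b

  ≤⇒≯ : ∀ {a b} → a ≤ b → ¬ b < a
  ≤⇒≯ a≤b b<a = <-irrefl (≤-<-trans a≤b b<a)

  <-≤-total : ∀ a b → a < b ⊎ b ≤ a
  <-≤-total a b with compare a b
  ... | tri< a<b _ _  = inj₁ a<b
  ... | tri≈ _ refl _ = inj₂ ≤-refl
  ... | tri> _ _ b<a  = inj₂ (inj₁ b<a)

  ≮⇒≥ : ∀ {a b} → ¬ a < b → b ≤ a
  ≮⇒≥ {a} {b} a≮b with <-≤-total a b
  ... | inj₁ a<b = contradiction a<b a≮b
  ... | inj₂ b≤a = b≤a

  zero-unique : ∀ {a b} → IsZero a → IsZero b → a ≡ b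
  zero-unique {a} {b} a0 b0 = ≤-antisym (a0 b) (b0 a)

  suc-unique : ∀ {a b c} → IsSuc a b → IsSuc a c → b ≡ c
  suc-unique (a<b , b-least) (a<c , c-least) =
    ≤-antisym (b-least _ a<c) (c-least _ a<b)

  one-unique : ∀ {a b} → IsOne a → IsOne b → a ≡ b
  one-unique (z , z0 , za) (z′ , z′0 , z′b) with refl ← zero-unique z0 z′0 =
    suc-unique za z′b

  zero≢one : ∀ {a b} → IsZero a → IsOne b → a ≢ b
  zero≢one a0 (z , _ , z<a , _) refl = ≤⇒≯ (a0 z) z<a

  zero<limit : ∀ {a l} → IsZero a → IsLimit l → a < l
  zero<limit {a} {l} a0 (l≢0 , _) with a0 l
  ... | inj₁ a<l  = a<l
  ... | inj₂ refl = contradiction a0 l≢0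

  suc<limit : ∀ {a b l} → IsSuc a b → IsLimit l → a < l → b < l
  suc<limit {l = l} ab@(_ , b-least) (_ , l≢suc) a<l with b-least l a<l
  ... | inj₁ b<l  = b<l
  ... | inj₂ refl = contradiction ab (l≢suc _)

  module Classical (em : ExcludedMiddle ℓ) where

    least : (P : Pred Carrier ℓ) → ∃[ a ] P a → ∃[ m ] P m × (∀ n → P n → m ≤ n)
    least P ∃P with minimal {ℓ = ℓ} wellFounded em P ∃P
    ... | m , Pm , min = m , Pm , λ n Pn → ≮⇒≥ (min n Pn)

    zero-exists : Carrier → ∃[ z ] IsZero z
    zero-exists a with least (λ b → b ≡ b) (a , refl)
    ... | z , _ , z-least = z , λ b → z-least b refl

    suc-exists : ∀ {a b} → a < b → ∃[ c ] IsSuc a c × c ≤ b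
    suc-exists {a} {b} a<b with least (a <_) (b , a<b)
    ... | c , a<c , c-least = c , (a<c , c-least) , c-least b a<b

    data Kind (a : Carrier) : Set ℓ where
      is-zero  : IsZero a → Kind a
      is-suc   : ∀ b → IsSuc b a → Kind a
      is-limit : IsLimit a → Kind a

    kind : ∀ a → Kind a
    kind a with em {IsZero a} | em {∃[ b ] IsSuc b a}
    ... | yes a0 | _             = is-zero a0
    ... | no _   | yes (b , ba)  = is-suc b ba
    ... | no a≢0 | no ∄          = is-limit (a≢0 , λ b ba → ∄ (b , ba))

strictTotalOrder : ∀ {ℓ} {A : Set ℓ} {_<_ : Rel A ℓ} →
                   Transitive _<_ → Trichotomous _≡_ _<_ → IsStrictTotalOrder _≡_ _<_
strictTotalOrder {_<_ = _<_} <-trans compare = record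
  { isStrictPartialOrder = record
    { isEquivalence = isEquivalence
    ; irrefl        = irrefl
    ; trans         = <-trans
    ; <-resp-≈      = resp₂ _<_
    }
  ; compare = compare
  }
  where
  irrefl : ∀ {a b} → a ≡ b → ¬ a < b
  irrefl {a} refl a<a with compare a a
  ... | tri< _ a≢a _ = a≢a refl
  ... | tri≈ a≮a _ _ = a≮a a<a
  ... | tri> _ a≢a _ = a≢a refl

-- Limes inferior

sup-unique : ∀ {a r p} {A : Set a} {_≤_ : Rel A r} → (∀ {a b} → a ≤ b → b ≤ a → a ≡ b) →
             ∀ {P : Pred A p} {v w} → IsSup _≤_ P v → IsSup _≤_ P w → v ≡ w
sup-unique ≤-antisym (v-ub , v-least) (w-ub , w-least) = ≤-antisym (v-least _ w-ub) (w-least _ v-ub)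

module Liminf {a r ℓ : Level} {A : Set a} (_≤_ : Rel A r)
  (≤-refl : ∀ {a} → a ≤ a) (≤-trans : ∀ {a b c} → a ≤ b → b ≤ c → a ≤ c)
  (least : (P : Pred A (a ⊔ ℓ)) → ∃[ a ] P a → ∃[ m ] P m × (∀ n → P n → m ≤ n))
  where

  -- The limes inferior at l is also the supremum of the eventual lower
  -- bounds; unlike tail minima, these are easy to compare for two sequences.
  EventualBound : (θ : Ordinal ℓ) → (Ordinal.Carrier θ → A) → Ordinal.Carrier θ → Pred A _
  EventualBound θ f l m = ∃[ s ] s < l × (∀ t → s θ.≤ t → t < l → m ≤ f t)
    where module θ = Ordinal θ
          open θ using (_<_)

  module _ (θ : Ordinal ℓ) (f : Ordinal.Carrier θ → A) {l : Ordinal.Carrier θ} where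
    private module θ = Ordinal θ
    open OrdinalProperties θ using () renaming (≤-refl to ≤θ-refl; ≤-trans to ≤θ-trans)

    tail-min-exists : ∀ {s} → s θ.< l → ∃[ m ] IsTailMin _≤_ θ f l s m
    tail-min-exists {s} s<l
      with least (λ m → ∃[ t ] s θ.≤ t × t θ.< l × f t ≡ m) (f s , s , ≤θ-refl , s<l , refl)
    ... | m , attained , m-least = m , attained , λ t s≤t t<l → m-least (f t) (t , s≤t , t<l , refl)

    -- Tail minima are eventual bounds, and every eventual bound lies below the minimum of its own
    -- tail, which exists by well-foundedness. So both families have the same upper bounds.
    liminf⇒sup : ∀ {v} → IsLiminf _≤_ θ f l v → IsSup _≤_ (EventualBound θ f l) v
    liminf⇒sup {v} (ub , lub) = ub′ , λ w w-ub → lub w λ { m (s , s<l , _ , min) → w-ub m (s , s<l , min) }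
      where
      ub′ : ∀ m → EventualBound θ f l m → m ≤ v
      ub′ m (s , s<l , bound) with tail-min-exists s<l
      ... | n , min@((t , s≤t , t<l , refl) , _) = ≤-trans (bound t s≤t t<l) (ub n (s , s<l , min))

    sup⇒liminf : ∀ {v} → IsSup _≤_ (EventualBound θ f l) v → IsLiminf _≤_ θ f l v
    sup⇒liminf {v} (ub , lub) = (λ { m (s , s<l , _ , min) → ub m (s , s<l , min) }) , λ w w-ub → lub w (lub′ w w-ub)
      where
      lub′ : ∀ w → (∀ m → ∃[ s ] s θ.< l × IsTailMin _≤_ θ f l s m → m ≤ w) →
             ∀ m → EventualBound θ f l m → m ≤ w
      lub′ w w-ub m (s , s<l , bound) with tail-min-exists s<l
      ... | n , min@((t , s≤t , t<l , refl) , _) = ≤-trans (bound t s≤t t<l) (w-ub n (s , s<l , min))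

    greatest⇒liminf : ∀ {v} → EventualBound θ f l v → (∀ m → EventualBound θ f l m → m ≤ v) →
                      IsLiminf _≤_ θ f l v
    greatest⇒liminf {v} v-bound greatest = sup⇒liminf (greatest , λ w w-ub → w-ub v v-bound)

    liminf-const : ∀ {s v} → s θ.< l → (∀ t → t θ.< l → f t ≡ v) → IsLiminf _≤_ θ f l v
    liminf-const {s} {v} s<l f≡v = greatest⇒liminf
      (s , s<l , λ t _ t<l → subst (v ≤_) (sym (f≡v t t<l)) ≤-refl)
      λ { m (s , s<l , bound) → subst (m ≤_) (f≡v s s<l) (bound s ≤θ-refl s<l) }

  module _ {θ θ′ : Ordinal ℓ} {f : Ordinal.Carrier θ → A} {f′ : Ordinal.Carrier θ′ → A}
           {l : Ordinal.Carrier θ} {l′ : Ordinal.Carrier θ′} where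

    sup-cong : (∀ m → EventualBound θ f l m → EventualBound θ′ f′ l′ m) →
               (∀ m → EventualBound θ′ f′ l′ m → EventualBound θ f l m) →
               ∀ {v} → IsSup _≤_ (EventualBound θ f l) v → IsSup _≤_ (EventualBound θ′ f′ l′) v
    sup-cong to from (ub , lub) =
      (λ m → ub m ∘ from m) , λ w w-ub → lub w λ m → w-ub m ∘ to m

    -- Only the eventual bounds matter: the two sequences may live on different clocks and need not
    -- agree term by term.
    liminf-transfer : (∀ m → EventualBound θ f l m → EventualBound θ′ f′ l′ m) →
                      (∀ m → EventualBound θ′ f′ l′ m → EventualBound θ f l m) →
                      ∀ {v} → IsLiminf _≤_ θ f l v → IsLiminf _≤_ θ′ f′ l′ v
    liminf-transfer to from = sup⇒liminf θ′ f′ ∘ sup-cong to from ∘ liminf⇒sup θ f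

module NatLiminf {ℓ : Level} (em : ExcludedMiddle ℓ) where

  least : (P : Pred ℕ ℓ) → ∃[ a ] P a → ∃[ m ] P m × (∀ n → P n → m ℕ.≤ n)
  least P ∃P with minimal {ℓ = ℓ} ℕᵢ.<-wellFounded em P ∃P
  ... | m , Pm , min = m , Pm , λ n Pn → ℕₚ.≮⇒≥ (min n Pn)

  open Liminf {ℓ = ℓ} ℕ._≤_ ℕₚ.≤-refl ℕₚ.≤-trans least public

  -- Monotonicity suffices in place of continuity because values are natural numbers: the limes
  -- inferior `v` is then itself an eventual bound, and values at most `v` recur in every tail, as
  -- otherwise `suc v` would be an eventual bound.
  liminf-mono : ∀ (θ : Ordinal ℓ) {f : Ordinal.Carrier θ → ℕ} {l v} → ∃[ s ] Ordinal._<_ θ s l →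
                (g : ℕ → ℕ) → (∀ {i j} → i ℕ.≤ j → g i ℕ.≤ g j) →
                IsLiminf ℕ._≤_ θ f l v → IsLiminf ℕ._≤_ θ (g ∘ f) l (g v)
  liminf-mono θ {f} {l} {v} (s₀ , s₀<l) g g-mono liminf =
    greatest⇒liminf θ (g ∘ f) (mono v (attained v lub)) gv-greatest
    where
    open Ordinal θ
    ub  = proj₁ (liminf⇒sup θ f liminf)
    lub = proj₂ (liminf⇒sup θ f liminf)
    mono : ∀ m → EventualBound θ f l m → EventualBound θ (g ∘ f) l (g m)
    mono m (s , s<l , bound) = s , s<l , λ t s≤t t<l → g-mono (bound t s≤t t<l)
    weaken : ∀ {m n} → m ℕ.≤ n → EventualBound θ f l n → EventualBound θ f l m
    weaken m≤n (s , s<l , bound) = s , s<l , λ t s≤t t<l → ℕₚ.≤-trans m≤n (bound t s≤t t<l)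
    attained : ∀ v → (∀ w → (∀ m → EventualBound θ f l m → m ℕ.≤ w) → v ℕ.≤ w) → EventualBound θ f l v
    -- A supremum of 0 would also arise from an empty family of bounds; the earlier time `s₀`
    -- excludes this.
    attained zero    _   = s₀ , s₀<l , λ _ _ _ → ℕ.z≤n
    attained (suc w) lub with em {EventualBound θ f l (suc w)}
    ... | yes bound = bound
    ... | no ¬bound = contradiction
      (lub w λ m m-bound → ℕₚ.≮⇒≥ λ w<m → ¬bound (weaken w<m m-bound)) ℕₚ.1+n≰n
    gv-greatest : ∀ m → EventualBound θ (g ∘ f) l m → m ℕ.≤ g v
    gv-greatest m (s , s<l , bound) with em {∃[ t ] s ≤ t × t < l × f t ℕ.≤ v}
    ... | yes (t , s≤t , t<l , ft≤v) = ℕₚ.≤-trans (bound t s≤t t<l) (g-mono ft≤v)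
    ... | no ∄ = contradiction
      (ub (suc v) (s , s<l , λ t s≤t t<l → ℕₚ.≰⇒> λ ft≤v → ∄ (t , s≤t , t<l , ft≤v))) ℕₚ.1+n≰n

-- Lexicographic sums of well-orders

module Sum {ℓ : Level} (θ : Ordinal ℓ) (B : Ordinal.Carrier θ → Ordinal ℓ)
  (first : ∀ t → Ordinal.Carrier (B t)) (first-zero : ∀ t → Ordinal.IsZero (B t) (first t))
  (last : ∀ t → Ordinal.Carrier (B t)) (last-max : ∀ t b → Ordinal._≤_ (B t) b (last t))
  where
  private
    module θ = Ordinal θ
    module B t = Ordinal (B t)
    module θₚ = OrdinalProperties θ
    module Bₚ t = OrdinalProperties (B t)

  Index : Set ℓ
  Index = Σ[ t ∈ θ.Carrier ] B.Carrier t

  infix 4 _<ₗ_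
  data _<ₗ_ : Rel Index ℓ where
    left  : ∀ {s t b c} → s θ.< t → (s , b) <ₗ (t , c)
    right : ∀ {t b c} → B._<_ t b c → (t , b) <ₗ (t , c)

  <ₗ-trans : Transitive _<ₗ_
  <ₗ-trans (left s<t)  (left t<u)  = left (θₚ.<-trans s<t t<u)
  <ₗ-trans (left s<t)  (right _)   = left s<t
  <ₗ-trans (right _)   (left s<t)  = left s<t
  <ₗ-trans (right b<c) (right c<d) = right (Bₚ.<-trans _ b<c c<d)

  <ₗ-irrefl : ∀ {i} → ¬ i <ₗ i
  <ₗ-irrefl (left t<t)  = θₚ.<-irrefl t<t
  <ₗ-irrefl (right b<b) = Bₚ.<-irrefl _ b<b

  <ₗ-compare : Trichotomous _≡_ _<ₗ_
  <ₗ-compare (s , b) (t , c) with θₚ.compare s t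
  ... | tri< s<t s≢t s≯t = tri< (left s<t) (λ { refl → s≢t refl }) λ i>j → <ₗ-irrefl (<ₗ-trans (left s<t) i>j)
  ... | tri> s≮t s≢t s>t = tri> (λ i<j → <ₗ-irrefl (<ₗ-trans i<j (left s>t))) (λ { refl → s≢t refl }) (left s>t)
  ... | tri≈ _ refl _ with Bₚ.compare s b c
  ...   | tri< b<c b≢c _ = tri< (right b<c) (λ { refl → b≢c refl }) λ i>j → <ₗ-irrefl (<ₗ-trans (right b<c) i>j)
  ...   | tri≈ _ refl _  = tri≈ <ₗ-irrefl refl <ₗ-irrefl
  ...   | tri> _ b≢c b>c = tri> (λ i<j → <ₗ-irrefl (<ₗ-trans i<j (right b>c))) (λ { refl → b≢c refl }) (right b>c)

  <ₗ-wellFounded : WellFounded _<ₗ_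
  <ₗ-wellFounded (t , b) = go (θ.wellFounded t) (B.wellFounded t b)
    where
    mutual
      go : ∀ {t b} → Acc θ._<_ t → Acc (B._<_ t) b → Acc _<ₗ_ (t , b)
      go at ab = acc (go′ at ab)

      go′ : ∀ {t b j} → Acc θ._<_ t → Acc (B._<_ t) b → j <ₗ (t , b) → Acc _<ₗ_ j
      go′ (acc rs) _        (left s<t)  = go (rs s<t) (B.wellFounded _ _)
      go′ at       (acc rs) (right c<b) = go at (rs c<b)

  ∑ : Ordinal ℓ
  ∑ = record
    { Carrier            = Index
    ; _<_                = _<ₗ_
    ; isStrictTotalOrder = strictTotalOrder <ₗ-trans <ₗ-compare
    ; wellFounded        = <ₗ-wellFounded
    }

  open Ordinal ∑ using (_≤_; IsSuc; IsLimit; IsZero)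
  private module ∑ₚ = OrdinalProperties ∑

  right-≤ : ∀ {t b c} → B._≤_ t b c → (t , b) ≤ (t , c)
  right-≤ (inj₁ b<c)  = inj₁ (right b<c)
  right-≤ (inj₂ refl) = inj₂ refl

  right-≤⁻ : ∀ {t b c} → (t , b) ≤ (t , c) → B._≤_ t b c
  right-≤⁻ {t} {b} {c} b≤c = Bₚ.≮⇒≥ t λ c<b → ∑ₚ.≤⇒≯ b≤c (right c<b)

  left-≤⁻ : ∀ {s t b c} → (s , b) ≤ (t , c) → s θ.≤ t
  left-≤⁻ (inj₁ (left s<t)) = inj₁ s<t
  left-≤⁻ (inj₁ (right _))  = inj₂ refl
  left-≤⁻ (inj₂ refl)       = inj₂ refl

  below-first : ∀ {i t} → i <ₗ (t , first t) → proj₁ i θ.< t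
  below-first (left s<t)  = s<t
  below-first (right b<0) = contradiction b<0 (Bₚ.≤⇒≯ _ (first-zero _ _))

  first-least : ∀ {t} → θ.IsZero t → IsZero (t , first t)
  first-least {t} t0 (s , b) with t0 s
  ... | inj₁ t<s  = inj₁ (left t<s)
  ... | inj₂ refl = right-≤ (first-zero t b)

  last-greatest : ∀ {t} → (∀ s → s θ.≤ t) → ∀ i → i ≤ (t , last t)
  last-greatest {t} t-max (s , b) with t-max s
  ... | inj₁ s<t  = inj₁ (left s<t)
  ... | inj₂ refl = right-≤ (last-max t b)

  data SucView : Rel Index ℓ where
    across : ∀ {s t} → θ.IsSuc s t → SucView (s , last s) (t , first t)
    within : ∀ {t b c} → B.IsSuc t b c → SucView (t , b) (t , c)

  suc-view : ∀ {i j} → IsSuc i j → SucView i j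
  suc-view {s , b} {t , c} (left s<t , least) with last-max s b | first-zero t c
  ... | inj₁ b<l  | _        = contradiction (least (s , last s) (right b<l)) (λ j≤ → ∑ₚ.≤⇒≯ j≤ (left s<t))
  ... | inj₂ refl | inj₁ 0<c = contradiction (least (t , first t) (left s<t)) (λ j≤ → ∑ₚ.≤⇒≯ j≤ (right 0<c))
  ... | inj₂ refl | inj₂ refl = across (s<t , λ u s<u → left-≤⁻ (least (u , first u) (left s<u)))
  suc-view {t , b} {t , c} (right b<c , least) =
    within (b<c , λ d b<d → right-≤⁻ (least (t , d) (right b<d)))

  -- The first element over a successor index is preceded by the last element of the previous
  -- summand, so it is never a limit.
  data LimitView : Pred Index ℓ where
    at-first : ∀ {t} → θ.IsLimit t → LimitView (t , first t)
    inside   : ∀ {t c} → B._<_ t (first t) c → B.IsLimit t c → LimitView (t , c)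

  limit-view : ∀ {i} → IsLimit i → LimitView i
  limit-view {t , c} (≢zero , ≢suc) with first-zero t c
  ... | inj₁ 0<c  = inside 0<c
    ( (λ c0 → Bₚ.≤⇒≯ t (c0 (first t)) 0<c)
    , λ b (b<c , least) → ≢suc (t , b) (right b<c , λ where
        (u , d) (left t<u)  → inj₁ (left t<u)
        (u , d) (right b<d) → right-≤ (least d b<d)))
  ... | inj₂ refl = at-first
    ( (λ t0 → ≢zero (first-least t0))
    , λ s (s<t , least) → ≢suc (s , last s) (left s<t , λ where
        (u , d) (right l<d) → contradiction l<d (Bₚ.≤⇒≯ s (last-max s d))
        (u , d) (left s<u)  → first-below (least u s<u)))
    where
    first-below : ∀ {u d} → t θ.≤ u → (t , first t) ≤ (u , d)
    first-below (inj₁ t<u)  = inj₁ (left t<u)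
    first-below (inj₂ refl) = right-≤ (first-zero t _)

  module _ {a r} {A : Set a} (_≤ᴬ_ : Rel A r)
    (≤-refl : ∀ {a} → a ≤ᴬ a) (≤-trans : ∀ {a b c} → a ≤ᴬ b → b ≤ᴬ c → a ≤ᴬ c)
    (least : (P : Pred A (a ⊔ ℓ)) → ∃[ a ] P a → ∃[ m ] P m × (∀ n → P n → m ≤ᴬ n))
    (F : Index → A)
    where
    open Liminf {ℓ = ℓ} _≤ᴬ_ ≤-refl ≤-trans least

    liminf-inside : ∀ {t c v} → B._<_ t (first t) c →
                    IsLiminf _≤ᴬ_ (B t) (λ b → F (t , b)) c v → IsLiminf _≤ᴬ_ ∑ F (t , c) v
    liminf-inside {t} {c} 0<c = liminf-transfer {B t} {∑} to from
      where
      to : ∀ m → EventualBound (B t) (λ b → F (t , b)) c m → EventualBound ∑ F (t , c) m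
      to m (s , s<c , bound) = (t , s) , right s<c , λ where
        (_ , d) s≤d (right d<c) → bound d (right-≤⁻ s≤d) d<c
        (u , d) s≤d (left u<t)  → contradiction u<t (θₚ.≤⇒≯ (left-≤⁻ s≤d))
      from : ∀ m → EventualBound ∑ F (t , c) m → EventualBound (B t) (λ b → F (t , b)) c m
      from m ((_ , s) , right s<c , bound) = s , s<c , λ d s≤d d<c → bound (t , d) (right-≤ s≤d) (right d<c)
      -- A tail that starts in an earlier summand contains everything over `t` below `c`, so it may
      -- be restarted at `first t`.
      from m ((u , s) , left u<t , bound)  = first t , 0<c , λ d _ d<c → bound (t , d) (inj₁ (left u<t)) (right d<c)

    -- Values inside the summand over s may fall below the value at its first
    -- element, provided that the first value of a later summand is as low.
    liminf-across : ExcludedMiddle ℓ → ∀ {t v} → θ.IsLimit t → (f : θ.Carrier → A) →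
                    (∀ s → F (s , first s) ≡ f s) →
                    (∀ s b → s θ.< t → ∃[ s′ ] s θ.≤ s′ × s′ θ.< t × f s′ ≤ᴬ F (s , b)) →
                    IsLiminf _≤ᴬ_ θ f t v → IsLiminf _≤ᴬ_ ∑ F (t , first t) v
    liminf-across em {t} t-limit f F-first F-low = liminf-transfer {θ} {∑} to from
      where
      to : ∀ m → EventualBound θ f t m → EventualBound ∑ F (t , first t) m
      to m (s , s<t , bound) = (s , first s) , left s<t , λ (u , d) s≤u u<t →
        let v , u≤v , v<t , fv≤F = F-low u d (below-first u<t)
        in ≤-trans (bound v (θₚ.≤-trans (left-≤⁻ s≤u) u≤v) v<t) fv≤F
      from : ∀ m → EventualBound ∑ F (t , first t) m → EventualBound θ f t m
      from m ((s , b) , s<t , bound) =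
        -- The tail may start in the middle of the summand over `s`, so first elements are covered
        -- only from the next index on.
        let s⁺ , suc-s , _ = θₚ.Classical.suc-exists em (below-first s<t)
        in s⁺ , θₚ.suc<limit suc-s t-limit (below-first s<t) , λ u s⁺≤u u<t →
           subst (m ≤ᴬ_) (F-first u) (bound (u , first u) (inj₁ (left (θₚ.<-≤-trans (proj₁ suc-s) s⁺≤u))) (left u<t))

-- Initial segments of a clock

module Truncation {ℓ : Level} (θ : Ordinal ℓ) (e : Ordinal.Carrier θ) where
  private
    module θ = Ordinal θ
    module θₚ = OrdinalProperties θ

  -- The bound is irrelevant, so elements with equal values are equal, as trichotomy for `_≡_`
  -- demands. The proof is recovered by deciding the order.
  record Below : Set ℓ where
    constructor below
    field
      value   : θ.Carrier
      .bounded : value θ.≤ e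
  open Below public

  ≤e : ∀ i → value i θ.≤ e
  ≤e (below t t≤e) with θₚ.<-≤-total e t
  ... | inj₂ t≤e = t≤e
  ... | inj₁ e<t = contradiction e<t (θₚ.≤⇒≯ (recompute (≤-dec t) t≤e))
    where
    ≤-dec : ∀ t → Dec (t θ.≤ e)
    ≤-dec t with θₚ.<-≤-total e t
    ... | inj₁ e<t = no λ t≤e → θₚ.≤⇒≯ t≤e e<t
    ... | inj₂ t≤e = yes t≤e

  Below-compare : Trichotomous _≡_ (θ._<_ on value)
  Below-compare (below s _) (below t _) with θₚ.compare s t
  ... | tri< s<t s≢t s≯t  = tri< s<t (λ { refl → s≢t refl }) s≯t
  ... | tri≈ s≮t refl s≯t = tri≈ s≮t refl s≯t
  ... | tri> s≮t s≢t s>t  = tri> s≮t (λ { refl → s≢t refl }) s>t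

  truncation : Ordinal ℓ
  truncation = record
    { Carrier            = Below
    ; _<_                = θ._<_ on value
    ; isStrictTotalOrder = strictTotalOrder θₚ.<-trans Below-compare
    ; wellFounded        = On.wellFounded value θ.wellFounded
    }

  open Ordinal truncation

  value-≤ : ∀ {i j} → i ≤ j → value i θ.≤ value j
  value-≤ (inj₁ i<j)  = inj₁ i<j
  value-≤ (inj₂ refl) = inj₂ refl

  value-≤⁻ : ∀ {i j} → value i θ.≤ value j → i ≤ j
  value-≤⁻ (inj₁ i<j)  = inj₁ i<j
  value-≤⁻ (inj₂ refl) = inj₂ refl

  value-zero⁻ : ∀ {i} → θ.IsZero (value i) → IsZero i
  value-zero⁻ i0 j = value-≤⁻ (i0 (value j))

  value-suc : ∀ {i j} → IsSuc i j → θ.IsSuc (value i) (value j)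
  value-suc {i} {j} (i<j , least) = i<j , λ t i<t → case t i<t (θₚ.<-≤-total e t)
    where
    case : ∀ t → value i θ.< t → e θ.< t ⊎ t θ.≤ e → value j θ.≤ t
    case t i<t (inj₁ e<t) = inj₁ (θₚ.≤-<-trans (≤e j) e<t)
    case t i<t (inj₂ t≤e) = value-≤ (least (below t t≤e) i<t)

  value-limit : ∀ {i} → IsLimit i → θ.IsLimit (value i)
  value-limit {i} (≢zero , ≢suc) = (λ i0 → ≢zero (value-zero⁻ i0)) , λ s (s<i , least) →
    ≢suc (below s (inj₁ (θₚ.<-≤-trans s<i (≤e i)))) (s<i , λ j s<j → value-≤⁻ (least (value j) s<j))

  module _ {a r} {A : Set a} (_≤ᴬ_ : Rel A r)
    (≤-refl : ∀ {a} → a ≤ᴬ a) (≤-trans : ∀ {a b c} → a ≤ᴬ b → b ≤ᴬ c → a ≤ᴬ c)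
    (least : (P : Pred A (a ⊔ ℓ)) → ∃[ a ] P a → ∃[ m ] P m × (∀ n → P n → m ≤ᴬ n))
    where
    open Liminf {ℓ = ℓ} _≤ᴬ_ ≤-refl ≤-trans least

    liminf-value : ∀ (f : θ.Carrier → A) {i v} →
                   IsLiminf _≤ᴬ_ θ f (value i) v → IsLiminf _≤ᴬ_ truncation (f ∘ value) i v
    liminf-value f {i} = liminf-transfer {θ} {truncation} {l = value i} {i}
      (λ m (s , s<i , bound) → below s (inj₁ (θₚ.<-≤-trans s<i (≤e i))) , s<i ,
        λ t s≤t t<i → bound (value t) (value-≤ {below s _} {t} s≤t) t<i)
      (λ m (s , s<i , bound) → value s , s<i , λ t s≤t t<i →
        bound (below t (inj₁ (θₚ.<-≤-trans t<i (≤e i)))) (value-≤⁻ s≤t) t<i)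

-- Lookup as a relation: it carries no bound on the index, so it composes well when code is
-- concatenated or mapped.
data At : Program → ℕ → Command → Set where
  here  : ∀ {c cs} → At (c ∷ cs) 0 c
  there : ∀ {b c cs n} → At cs n c → At (b ∷ cs) (suc n) c

at-lookup : ∀ P {n} (n< : n ℕ.< length P) → At P n (lookup P (fromℕ< n<))
at-lookup (c ∷ P) {zero}  _          = here
at-lookup (c ∷ P) {suc n} (ℕ.s≤s n<) = there (at-lookup P n<)

at-< : ∀ {P n c} → At P n c → n ℕ.< length P
at-< here      = ℕ.s≤s ℕ.z≤n
at-< (there p) = ℕ.s≤s (at-< p)

at-unique : ∀ {P n b c} → At P n b → At P n c → b ≡ c
at-unique here      here      = refl
at-unique (there p) (there q) = at-unique p q

-- Matching times by order type

-- The clocks of two runs are different well-orders; their times are matched by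
-- order type.
data SameRank {ℓ} (θ θ′ : Ordinal ℓ) (t : Ordinal.Carrier θ) (t′ : Ordinal.Carrier θ′) : Set ℓ where
  same-rank : (∀ s → Ordinal._<_ θ s t → ∃[ s′ ] Ordinal._<_ θ′ s′ t′ × SameRank θ θ′ s s′) →
              (∀ s′ → Ordinal._<_ θ′ s′ t′ → ∃[ s ] Ordinal._<_ θ s t × SameRank θ θ′ s s′) →
              SameRank θ θ′ t t′

rank-sym : ∀ {ℓ} {θ θ′ : Ordinal ℓ} {t t′} → SameRank θ θ′ t t′ → SameRank θ′ θ t′ t
rank-sym {θ = θ} {θ′} {t} {t′} t~t′ = go (Ordinal.wellFounded θ t) t~t′
  where
  go : ∀ {t t′} → Acc (Ordinal._<_ θ) t → SameRank θ θ′ t t′ → SameRank θ′ θ t′ t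
  go (acc rs) (same-rank forth back) = same-rank
    (λ s′ s′<t′ → let s , s<t , s~s′ = back s′ s′<t′ in s , s<t , go (rs s<t) s~s′)
    (λ s s<t → let s′ , s′<t′ , s~s′ = forth s s<t in s′ , s′<t′ , go (rs s<t) s~s′)

module SameRankProperties {ℓ} (θ θ′ : Ordinal ℓ) where
  private
    module θ = Ordinal θ
    module θ′ = Ordinal θ′
    module θₚ = OrdinalProperties θ
    module θ′ₚ = OrdinalProperties θ′

  infix 4 _~_
  _~_ : θ.Carrier → θ′.Carrier → Set ℓ
  _~_ = SameRank θ θ′

  -- Descent on `t`: as `a` lies below `b`, some `u` below `t` has the rank of `a`; matching `u`
  -- through `a` gives it the rank of some `c` below `a` as well. The same conflict recurs at `u`.
  no-two-ranks : ∀ {t a b} → Acc θ._<_ t → t ~ a → t ~ b → ¬ a θ′.< b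
  no-two-ranks (acc rs) (same-rank t⇒a _) (same-rank _ b⇒t) a<b =
    let u , u<t , u~a  = b⇒t _ a<b
        c , c<a , u~c = t⇒a u u<t
    in no-two-ranks (rs u<t) u~c u~a c<a

  rank-unique : ∀ {t a b} → t ~ a → t ~ b → a ≡ b
  rank-unique {t} {a} {b} t~a t~b with θ′ₚ.compare a b
  ... | tri< a<b _ _ = contradiction a<b (no-two-ranks (θ.wellFounded t) t~a t~b)
  ... | tri≈ _ a≡b _ = a≡b
  ... | tri> _ _ b<a = contradiction b<a (no-two-ranks (θ.wellFounded t) t~b t~a)

  rank-mono : ∀ {s t a b} → s ~ a → t ~ b → s θ.< t → a θ′.< b
  rank-mono s~a (same-rank t⇒b _) s<t with t⇒b _ s<t
  ... | c , c<b , s~c with refl ← rank-unique s~a s~c = c<b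

  rank-zero : ∀ {t t′} → t ~ t′ → θ.IsZero t → θ′.IsZero t′
  rank-zero (same-rank _ back) t0 s′ = θ′ₚ.≮⇒≥ λ s′<t′ →
    let s , s<t , _ = back s′ s′<t′ in θₚ.≤⇒≯ (t0 s) s<t

module _ {ℓ} {θ θ′ : Ordinal ℓ} where
  private
    module θ = Ordinal θ
    module θ′ = Ordinal θ′
    module θₚ = OrdinalProperties θ
    module θ′ₚ = OrdinalProperties θ′
    module to = SameRankProperties θ θ′
    module from = SameRankProperties θ′ θ
  open to

  rank-mono⁻ : ∀ {s t a b} → s ~ a → t ~ b → a θ′.< b → s θ.< t
  rank-mono⁻ s~a t~b = from.rank-mono (rank-sym s~a) (rank-sym t~b)

  rank-suc : ∀ {s t t′} → t ~ t′ → θ.IsSuc s t → ∃[ s′ ] s ~ s′ × θ′.IsSuc s′ t′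
  rank-suc {s} {t} {t′} t~t′@(same-rank forth back) (s<t , least) with forth s s<t
  ... | s′ , s′<t′ , s~s′ = s′ , s~s′ , s′<t′ , λ c′ s′<c′ → θ′ₚ.≮⇒≥ λ c′<t′ →
    let c , c<t , c~c′ = back c′ c′<t′
    in θₚ.≤⇒≯ (least c (rank-mono⁻ s~s′ c~c′ s′<c′)) c<t

module _ {ℓ} {θ θ′ : Ordinal ℓ} where
  private
    module θ = Ordinal θ
    module θ′ = Ordinal θ′

  rank-limit : ∀ {t t′} → SameRank θ θ′ t t′ → θ.IsLimit t → θ′.IsLimit t′
  rank-limit t~t′ (≢zero , ≢suc) =
    (λ t′0 → ≢zero (SameRankProperties.rank-zero θ′ θ (rank-sym t~t′) t′0)) ,
    λ s′ s′t′ → let s , _ , st = rank-suc (rank-sym t~t′) s′t′ in ≢suc s st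

-- Determinism of halting runs

module Runs {ℓ : Level} (em : ExcludedMiddle ℓ) (α : Ordinal ℓ) where
  open Machine α
  private
    module α = Ordinal α
    module αₚ = OrdinalProperties α
    module αᶜ = αₚ.Classical em
  module Lines = NatLiminf em
  module Regs = Liminf {ℓ = ℓ} α._≤_ αₚ.≤-refl αₚ.≤-trans αᶜ.least

  IsLiminfConfig : (θ : Ordinal ℓ) → (Ordinal.Carrier θ → Config) → Ordinal.Carrier θ → Config → Set ℓ
  IsLiminfConfig θ conf l c =
    IsLiminf ℕ._≤_ θ (line ∘ conf) l (line c) ×
    (∀ j → IsLiminf α._≤_ θ (λ t → reg (conf t) j) l (reg c j))

  infix 4 _≈_
  _≈_ : Rel Config ℓ
  c ≈ d = line c ≡ line d × (∀ i → reg c i ≡ reg d i)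

  char-unique : ∀ {x ι v w} → IsChar x ι v → IsChar x ι w → v ≡ w
  char-unique (inj₁ (_ , v1))   (inj₁ (_ , w1))   = αₚ.one-unique v1 w1
  char-unique (inj₁ (ι∈x , _))  (inj₂ (ι∉x , _))  = contradiction ι∈x ι∉x
  char-unique (inj₂ (ι∉x , _))  (inj₁ (ι∈x , _))  = contradiction ι∈x ι∉x
  char-unique (inj₂ (_ , v0))   (inj₂ (_ , w0))   = αₚ.zero-unique v0 w0

  at⇒step : ∀ {P x c d cmd} → At P (line c) cmd → Exec x cmd c d → Step P x c d
  at⇒step {P} {x} {c} {d} p exec = at-< p , subst (λ cmd → Exec x cmd c d) (at-unique p (at-lookup P (at-< p))) exec

  step⇒at : ∀ {P x c d} → Step P x c d → ∃[ cmd ] At P (line c) cmd × Exec x cmd c d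
  step⇒at {P} (l< , exec) = _ , at-lookup P l< , exec

  unchanged-unique : ∀ {j c c′ d d′} → (∀ i → reg c i ≡ reg d i) → reg c′ j ≡ reg d′ j →
                     OthersUnchanged j c c′ → OthersUnchanged j d d′ → ∀ i → reg c′ i ≡ reg d′ i
  unchanged-unique {j} c≈d eq c-same d-same i with i ℕₚ.≟ j
  ... | yes refl = eq
  ... | no i≢j   = trans (c-same i i≢j) (trans (c≈d i) (sym (d-same i i≢j)))

  exec-unique : ∀ {x} cmd {c c′ d d′} → c ≈ d → Exec x cmd c c′ → Exec x cmd d d′ → c′ ≈ d′
  exec-unique (increment j) {c} {c′} {d} {d′} (lines , regs) (lc , vc , oc) (ld , vd , od) =
    trans lc (trans (cong suc lines) (sym ld)) ,
    unchanged-unique {j} {c} {c′} {d} {d′} regs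
      (αₚ.suc-unique vc (subst (λ v → α.IsSuc v (reg d′ j)) (sym (regs j)) vd)) oc od
  exec-unique (copy i j) {c} {c′} {d} {d′} (lines , regs) (lc , vc , oc) (ld , vd , od) =
    trans lc (trans (cong suc lines) (sym ld)) ,
    unchanged-unique {j} {c} {c′} {d} {d′} regs (trans vc (trans (regs i) (sym vd))) oc od
  exec-unique {x} (oracle j) {c} {c′} {d} {d′} (lines , regs) (lc , vc , oc) (ld , vd , od) =
    trans lc (trans (cong suc lines) (sym ld)) ,
    unchanged-unique {j} {c} {c′} {d} {d′} regs
      (char-unique {x} vc (subst (λ v → IsChar x v (reg d′ j)) (sym (regs j)) vd)) oc od
  exec-unique (jump-if-≡ i j l) (lines , regs) (jc , oc) (jd , od) =
    jumps jc jd , λ k → trans (oc k) (trans (regs k) (sym (od k)))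
    where
    jumps : _ → _ → _
    jumps (inj₁ (_ , lc))  (inj₁ (_ , ld))  = trans lc (sym ld)
    jumps (inj₂ (_ , lc))  (inj₂ (_ , ld))  = trans lc (trans (cong suc lines) (sym ld))
    jumps (inj₁ (eq , _))  (inj₂ (neq , _)) = contradiction (trans (sym (regs i)) (trans eq (regs j))) neq
    jumps (inj₂ (neq , _)) (inj₁ (eq , _))  = contradiction (trans (regs i) (trans eq (sym (regs j)))) neq

  step-unique : ∀ {P x c c′ d d′} → c ≈ d → Step P x c c′ → Step P x d d′ → c′ ≈ d′
  step-unique {P} {c = c} {d = d} c≈d@(lines , _) cc′ dd′ with step⇒at {P} cc′ | step⇒at {P} dd′
  ... | cmd , p , exec | cmd′ , p′ , exec′
    with refl ← at-unique p (subst (λ n → At P n cmd′) (sym lines) p′) = exec-unique cmd c≈d exec exec′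

  initial-unique : ∀ ξs {r r′} → InitialRegs ξs r → InitialRegs ξs r′ → ∀ i → r i ≡ r′ i
  initial-unique []       r0 r′0 i = αₚ.zero-unique (r0 i) (r′0 i)
  initial-unique (ξ ∷ ξs) (r0 , _)  (r′0 , _)  zero    = trans r0 (sym r′0)
  initial-unique (ξ ∷ ξs) (_ , rs)  (_ , r′s)  (suc i) = initial-unique ξs rs r′s i

  module RunProperties {P x ξs} (ρ : HaltingRun P x ξs) where
    open HaltingRun ρ public
    open Ordinal time public
    module Time = OrdinalProperties time
    module Timeᶜ = Time.Classical em

    step-before-end : ∀ {t} → t < end → ∃[ t⁺ ] IsSuc t t⁺ × Step P x (conf t) (conf t⁺)
    step-before-end t<e with Timeᶜ.suc-exists t<e
    ... | t⁺ , suc-t , _ = t⁺ , suc-t , successor _ _ suc-t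

    halted⇒end : ∀ {t} → Halted P (conf t) → t ≡ end
    halted⇒end {t} halt with end-last t
    ... | inj₂ t≡e = t≡e
    ... | inj₁ t<e = let _ , _ , l< , _ = step-before-end t<e in contradiction halt (ℕₚ.<⇒≱ l<)

  module _ {P x ξs} (ρ ρ′ : HaltingRun P x ξs) where
    private
      module ρ = RunProperties ρ
      module ρ′ = RunProperties ρ′
    open SameRankProperties ρ.time ρ′.time

    -- At a limit both runs have the same eventual bounds: `forth` and `back` carry starts and
    -- members of tails between the clocks, and the induction hypothesis identifies the
    -- configurations found there.
    same-conf : ∀ {t t′} → Acc ρ._<_ t → t ~ t′ → ρ.conf t ≈ ρ′.conf t′
    same-conf {t} {t′} (acc rs) t~t′@(same-rank forth back) with ρ.Timeᶜ.kind t
    ... | ρ.Timeᶜ.is-zero t0 =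
      let t′0 = rank-zero t~t′ t0 in
      trans (ρ.initial-line t t0) (sym (ρ′.initial-line t′ t′0)) ,
      initial-unique ξs (ρ.initial-regs t t0) (ρ′.initial-regs t′ t′0)
    ... | ρ.Timeᶜ.is-suc s st =
      let s′ , s~s′ , s′t′ = rank-suc t~t′ st
      in step-unique {P} (same-conf (rs (proj₁ st)) s~s′) (ρ.successor s t st) (ρ′.successor s′ t′ s′t′)
    ... | ρ.Timeᶜ.is-limit t-lim =
      sup-unique ℕₚ.≤-antisym line-liminf (ρ′.limit-line t′ t′-lim) ,
      λ j → sup-unique αₚ.≤-antisym (reg-liminf j) (ρ′.limit-regs t′ t′-lim j)
      where
      t′-lim = rank-limit t~t′ t-lim

      module _ {a} {r} {A : Set a} (_≤ᴬ_ : Rel A r) (F : Config → A)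
        (F-cong : ∀ {c d} → c ≈ d → F c ≡ F d) where
        to : ∀ m → (∃[ s ] s ρ.< t × (∀ u → s ρ.≤ u → u ρ.< t → m ≤ᴬ F (ρ.conf u))) →
             ∃[ s′ ] s′ ρ′.< t′ × (∀ u′ → s′ ρ′.≤ u′ → u′ ρ′.< t′ → m ≤ᴬ F (ρ′.conf u′))
        to m (s , s<t , bound) with forth s s<t
        ... | s′ , s′<t′ , s~s′ = s′ , s′<t′ , λ u′ s′≤u′ u′<t′ →
          let u , u<t , u~u′ = back u′ u′<t′
              s≤u = ρ.Time.≮⇒≥ λ u<s → ρ′.Time.≤⇒≯ s′≤u′ (rank-mono u~u′ s~s′ u<s)
          in subst (m ≤ᴬ_) (F-cong (same-conf (rs u<t) u~u′)) (bound u s≤u u<t)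

        from : ∀ m → (∃[ s′ ] s′ ρ′.< t′ × (∀ u′ → s′ ρ′.≤ u′ → u′ ρ′.< t′ → m ≤ᴬ F (ρ′.conf u′))) →
               ∃[ s ] s ρ.< t × (∀ u → s ρ.≤ u → u ρ.< t → m ≤ᴬ F (ρ.conf u))
        from m (s′ , s′<t′ , bound) with back s′ s′<t′
        ... | s , s<t , s~s′ = s , s<t , λ u s≤u u<t →
          let u′ , u′<t′ , u~u′ = forth u u<t
              s′≤u′ = ρ′.Time.≮⇒≥ λ u′<s′ → ρ.Time.≤⇒≯ s≤u (rank-mono⁻ u~u′ s~s′ u′<s′)
          in subst (m ≤ᴬ_) (sym (F-cong (same-conf (rs u<t) u~u′))) (bound u′ s′≤u′ u′<t′)

      line-liminf : IsLiminf ℕ._≤_ ρ′.time (line ∘ ρ′.conf) t′ (line (ρ.conf t))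
      line-liminf = Lines.liminf-transfer {ρ.time} {ρ′.time}
        (to ℕ._≤_ line proj₁) (from ℕ._≤_ line proj₁) (ρ.limit-line t t-lim)
      reg-liminf : ∀ j → IsLiminf α._≤_ ρ′.time (λ u → reg (ρ′.conf u) j) t′ (reg (ρ.conf t) j)
      reg-liminf j = Regs.liminf-transfer {ρ.time} {ρ′.time}
        (to α._≤_ (λ c → reg c j) (λ c≈d → proj₂ c≈d j))
        (from α._≤_ (λ c → reg c j) (λ c≈d → proj₂ c≈d j)) (ρ.limit-regs t t-lim j)

    -- Otherwise, at the first time without a counterpart, all of ρ′ would
    -- have been matched, although only the last configuration is halted.
    counterpart : ∀ t → Acc ρ._<_ t → ∃[ t′ ] t ~ t′
    counterpart t (acc rs) with em {∃[ t′ ] t ~ t′}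
    ... | yes t~t′ = t~t′
    ... | no ∄ with em {∃[ s ] s ρ.< t × s ~ ρ′.end}
    -- The partner of the halting time of `ρ′` is halted as well, so it is the end of `ρ` and
    -- nothing comes after it.
    ...   | yes (s , s<t , s~e′) =
      let s≈e′ = same-conf (ρ.wellFounded s) s~e′
          s≡e  = ρ.halted⇒end (subst (length P ℕ.≤_) (sym (proj₁ s≈e′)) ρ′.end-halted)
      in contradiction (ρ.Time.<-≤-trans s<t (ρ.end-last t)) λ s<e → ρ.Time.<-irrefl (subst (s ρ.<_) (sym s≡e) s<e)
    -- The least time of `ρ′` that is unmatched below `t` turns out to have the rank of `t`.
    ...   | no ∄e′ with ρ′.Timeᶜ.least (λ t′ → ¬ (∃[ s ] s ρ.< t × s ~ t′)) (ρ′.end , ∄e′)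
    ...     | t′ , unmatched , least = contradiction (t′ , same-rank forth back) ∄
      where
      back : ∀ s′ → s′ ρ′.< t′ → ∃[ s ] s ρ.< t × s ~ s′
      back s′ s′<t′ with em {∃[ s ] s ρ.< t × s ~ s′}
      ... | yes matched = matched
      ... | no ¬matched = contradiction s′<t′ (ρ′.Time.≤⇒≯ (least s′ ¬matched))
      forth : ∀ s → s ρ.< t → ∃[ s′ ] s′ ρ′.< t′ × s ~ s′
      forth s s<t with counterpart s (rs s<t)
      ... | s′ , s~s′@(same-rank _ s′⇒s) with ρ′.Time.compare s′ t′
      ...   | tri< s′<t′ _ _ = s′ , s′<t′ , s~s′
      ...   | tri≈ _ refl _  = contradiction (s , s<t , s~s′) unmatched
      ...   | tri> _ _ t′<s′ = let u , u<s , u~t′ = s′⇒s t′ t′<s′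
                               in contradiction (u , ρ.Time.<-trans u<s s<t , u~t′) unmatched

    output-unique : HaltingRun.output ρ ≡ HaltingRun.output ρ′
    output-unique with counterpart ρ.end (ρ.wellFounded ρ.end)
    ... | t′ , e~t′ with same-conf (ρ.wellFounded ρ.end) e~t′
    ...   | e≈t′ with refl ← ρ′.halted⇒end (subst (length P ℕ.≤_) (proj₁ e≈t′) ρ.end-halted) = proj₂ e≈t′ 0

-- Composable pieces of computations

module Paths {ℓ : Level} (em : ExcludedMiddle ℓ) (α : Ordinal ℓ) where
  open Machine α
  open Runs em α
  private
    module α = Ordinal α
    module αₚ = OrdinalProperties α
    module αᶜ = αₚ.Classical em

  -- Unlike a `HaltingRun`, a path may begin and end in any configuration, so pieces can be joined.
  -- The invariant carries the information about inner configurations that limits of joined pieces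
  -- require.
  record Path (P : Program) (x : Subset) (I : Pred Config ℓ) (c d : Config) : Set (lsuc ℓ) where
    field
      time       : Ordinal ℓ
    open Ordinal time public
    field
      conf       : Carrier → Config
      first      : Carrier
      first-zero : IsZero first
      conf-first : conf first ≡ c
      last       : Carrier
      last-max   : ∀ t → t ≤ last
      conf-last  : conf last ≡ d
      successor  : ∀ s t → IsSuc s t → Step P x (conf s) (conf t)
      limit      : ∀ t → IsLimit t → IsLiminfConfig time conf t (conf t)
      invariant  : ∀ t → I (conf t)

  singleton : ∀ {P x I} c → I c → Path P x I c c
  singleton c Ic = record
    { time = record
      { Carrier            = ⊤
      ; _<_                = λ _ _ → ⊥
      ; isStrictTotalOrder = strictTotalOrder (λ ()) (λ _ _ → tri≈ (λ ()) refl (λ ()))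
      ; wellFounded        = λ _ → acc λ ()
      }
    ; conf       = λ _ → c
    ; first      = tt
    ; first-zero = λ _ → inj₂ refl
    ; conf-first = refl
    ; last       = tt
    ; last-max   = λ _ → inj₂ refl
    ; conf-last  = refl
    ; successor  = λ _ _ ()
    ; limit      = λ _ lim → contradiction (λ _ → inj₂ refl) (proj₁ lim)
    ; invariant  = λ _ → Ic
    }

  -- By `start-limit`, the starting configurations alone have the right limes inferior. The
  -- hypotheses `line-low` and `reg-low` prevent the configurations inside the pieces from lowering
  -- it: each inner value is at least some starting value at the same or a later index below the
  -- limit.
  module Concat {P x} (θ : Ordinal ℓ)
    {I : Ordinal.Carrier θ → Pred Config ℓ} {J : Pred Config ℓ} (I⇒J : ∀ t {c} → I t c → J c)
    (start stop : Ordinal.Carrier θ → Config)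
    (path : ∀ t → Path P x (I t) (start t) (stop t))
    (step : ∀ s t → Ordinal.IsSuc θ s t → Step P x (stop s) (start t))
    (start-limit : ∀ l → Ordinal.IsLimit θ l → IsLiminfConfig θ start l (start l))
    (line-low : ∀ l → Ordinal.IsLimit θ l → ∀ t c → Ordinal._<_ θ t l → I t c →
                ∃[ t′ ] Ordinal._≤_ θ t t′ × Ordinal._<_ θ t′ l × line (start t′) ℕ.≤ line c)
    (reg-low : ∀ l → Ordinal.IsLimit θ l → ∀ t c j → Ordinal._<_ θ t l → I t c →
               ∃[ t′ ] Ordinal._≤_ θ t t′ × Ordinal._<_ θ t′ l × reg (start t′) j α.≤ reg c j)
    where
    private
      module θ = Ordinal θ
      module path t = Path (path t)
    module ∑ = Sum θ path.time path.first path.first-zero path.last path.last-max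
    open ∑

    concat-conf : Index → Config
    concat-conf (t , b) = path.conf t b

    concat-limit : ∀ i → Ordinal.IsLimit ∑ i → IsLiminfConfig ∑ concat-conf i (concat-conf i)
    concat-limit i i-lim with limit-view i-lim
    ... | inside {t} {c} 0<c c-lim =
      liminf-inside ℕ._≤_ ℕₚ.≤-refl ℕₚ.≤-trans Lines.least (line ∘ concat-conf) 0<c (proj₁ (path.limit t c c-lim)) ,
      λ j → liminf-inside α._≤_ αₚ.≤-refl αₚ.≤-trans αᶜ.least (λ k → reg (concat-conf k) j) 0<c
              (proj₂ (path.limit t c c-lim) j)
    ... | at-first {t} t-lim rewrite path.conf-first t =
      liminf-across ℕ._≤_ ℕₚ.≤-refl ℕₚ.≤-trans Lines.least (line ∘ concat-conf) em t-lim (line ∘ start)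
        (λ s → cong line (path.conf-first s)) (λ s b s<t → line-low t t-lim s _ s<t (path.invariant s b))
        (proj₁ (start-limit t t-lim)) ,
      λ j → liminf-across α._≤_ αₚ.≤-refl αₚ.≤-trans αᶜ.least (λ k → reg (concat-conf k) j) em t-lim
        (λ s → reg (start s) j) (λ s → cong (λ c → reg c j) (path.conf-first s))
        (λ s b s<t → reg-low t t-lim s _ j s<t (path.invariant s b))
        (proj₂ (start-limit t t-lim) j)

    concat-successor : ∀ i j → Ordinal.IsSuc ∑ i j → Step P x (concat-conf i) (concat-conf j)
    concat-successor i j ij with suc-view ij
    ... | within {t} {b} {c} bc = path.successor t b c bc
    ... | across {s} {t} st =
      subst₂ (Step P x) (sym (path.conf-last s)) (sym (path.conf-first t)) (step s t st)

    concat : ∀ {first last} → θ.IsZero first → (∀ t → t θ.≤ last) → Path P x J (start first) (stop last)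
    concat {first} {last} first-zero last-max = record
      { time       = ∑
      ; conf       = concat-conf
      ; first      = first , path.first first
      ; first-zero = first-least first-zero
      ; conf-first = path.conf-first first
      ; last       = last , path.last last
      ; last-max   = last-greatest last-max
      ; conf-last  = path.conf-last last
      ; successor  = concat-successor
      ; limit      = concat-limit
      ; invariant  = λ (t , b) → I⇒J t (path.invariant t b)
      }

  -- Index order for joining two paths by one step. Neither element is a limit, so the limit
  -- conditions of `Concat` are vacuous.
  data Two : Set ℓ where
    one two : Two

  data _<₂_ : Rel Two ℓ where
    one<two : one <₂ two

  two-ordinal : Ordinal ℓ
  two-ordinal = record
    { Carrier            = Two
    ; _<_                = _<₂_
    ; isStrictTotalOrder = strictTotalOrder (λ { one<two () }) λ where
        one one → tri≈ (λ ()) refl (λ ())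
        one two → tri< one<two (λ ()) (λ ())
        two one → tri> (λ ()) (λ ()) one<two
        two two → tri≈ (λ ()) refl (λ ())
    ; wellFounded        = λ where
        one → acc λ ()
        two → acc λ { one<two → acc λ () }
    }

  open Ordinal two-ordinal using () renaming (IsZero to IsZero₂; IsLimit to IsLimit₂; _≤_ to _≤₂_)

  one-zero : IsZero₂ one
  one-zero one = inj₂ refl
  one-zero two = inj₁ one<two

  two-max : ∀ t → t ≤₂ two
  two-max one = inj₁ one<two
  two-max two = inj₂ refl

  two-no-limit : ∀ {a} {A : Set a} t → IsLimit₂ t → A
  two-no-limit one (≢zero , _) = contradiction one-zero ≢zero
  two-no-limit two (_ , ≢suc)  = contradiction
    (one<two , λ { one () ; two _ → inj₂ refl }) (≢suc one)

  module _ {P x I c d e f} (p : Path P x I c d) (de : Step P x d e) (q : Path P x I e f) where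
    private
      start stop : Two → Config
      start one = c
      start two = e
      stop one = d
      stop two = f
      path : ∀ t → Path P x I (start t) (stop t)
      path one = p
      path two = q
      step : ∀ s t → Ordinal.IsSuc two-ordinal s t → Step P x (stop s) (start t)
      step one two _         = de
      step one one (() , _)
      step two one (() , _)
      step two two (() , _)
    open Concat two-ordinal {J = I} (λ _ Ic → Ic) start stop path step
      (λ l → two-no-limit l) (λ l lim _ _ _ _ → two-no-limit l lim) (λ l lim _ _ _ _ _ → two-no-limit l lim)

    append : Path P x I c f
    append = concat one-zero two-max

    -- Keeps track of the configuration at the joint; for the search this is the moment at which a
    -- query is displayed.
    append-visits : ∃[ t ] Path.conf append t ≡ e
    append-visits = (two , Path.first q) , Path.conf-first q

  infixl 5 _▷⟨_⟩_
  _▷⟨_⟩_ : ∀ {P x I c d e} → Path P x I c d → Step P x d e → I e → Path P x I c e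
  p ▷⟨ de ⟩ Ie = append p de (singleton _ Ie)

  weaken : ∀ {P x I J c d} → (∀ {c} → I c → J c) → Path P x I c d → Path P x J c d
  weaken I⇒J p = record
    { Path p hiding (invariant)
    ; invariant = λ t → I⇒J (Path.invariant p t)
    }

  path⇒run : ∀ {P x I ξs c d} → line c ≡ 0 → InitialRegs ξs (reg c) → Halted P d →
             Path P x I c d → HaltingRun P x ξs
  path⇒run {P} {ξs = ξs} line-c regs-c halt p = record
    { time         = time
    ; conf         = conf
    ; initial-line = λ t t0 → trans (cong line (initial t0)) line-c
    ; initial-regs = λ t t0 → subst (InitialRegs ξs ∘ reg) (sym (initial t0)) regs-c
    ; successor    = successor
    ; limit-line   = λ t t-lim → proj₁ (limit t t-lim)
    ; limit-regs   = λ t t-lim → proj₂ (limit t t-lim)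
    ; end          = last
    ; end-last     = last-max
    ; end-halted   = subst (Halted P) (sym conf-last) halt
    }
    where
    open Path p
    initial : ∀ {t} → IsZero t → conf t ≡ _
    initial t0 = trans (cong conf (OrdinalProperties.zero-unique time t0 first-zero)) conf-first

  module Prefix {P x ξs} (ρ : HaltingRun P x ξs) where
    open RunProperties ρ

    first : Carrier
    first = proj₁ (Timeᶜ.zero-exists end)

    first-zero : IsZero first
    first-zero = proj₂ (Timeᶜ.zero-exists end)

    -- An arbitrary cut `e` is allowed because a rejecting simulation stops at the first mismatch,
    -- before the simulated search ends.
    prefix : ∀ e → Path P x U (conf first) (conf e)
    prefix e = record
      { time       = truncation
      ; conf       = conf ∘ value
      ; first      = below first (first-zero e)
      ; first-zero = value-zero⁻ first-zero
      ; conf-first = refl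
      ; last       = below e Time.≤-refl
      ; last-max   = λ i → value-≤⁻ (≤e i)
      ; conf-last  = refl
      ; successor  = λ s t st → successor _ _ (value-suc {s} {t} st)
      ; limit      = λ t t-lim →
          liminf-value ℕ._≤_ ℕₚ.≤-refl ℕₚ.≤-trans Lines.least (line ∘ conf) {t} (limit-line _ (value-limit {t} t-lim)) ,
          λ j → liminf-value α._≤_ αₚ.≤-refl αₚ.≤-trans αᶜ.least (λ t → reg (conf t) j) {t}
            (limit-regs _ (value-limit {t} t-lim) j)
      ; invariant  = λ _ → tt
      }
      where open Truncation time e

-- Layout of registers and code

-- The roles of the registers in a compiled program: host k and sub k hold
-- register k of the simulated program and of the called program.
data Slot : Set where
  result zer probe : Slot
  host sub         : ℕ → Slot

double : ℕ → ℕ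
double zero    = zero
double (suc k) = suc (suc (double k))

-- `result` must be register 0, which serves both as output and as the display of a search. Hosts
-- and subs alternate from 3 on, so neither family needs a bound on the other.
⌜_⌝ : Slot → ℕ
⌜ result ⌝ = 0
⌜ zer ⌝    = 1
⌜ probe ⌝  = 2
⌜ host k ⌝ = 3 ℕ.+ double k
⌜ sub k ⌝  = 4 ℕ.+ double k

shift : Slot → Slot
shift (host k) = host (suc k)
shift (sub k)  = sub (suc k)
shift s        = s

alternating : ℕ → Slot
alternating zero          = host zero
alternating (suc zero)    = sub zero
alternating (suc (suc n)) = shift (alternating n)

decode : ℕ → Slot
decode 0                   = result
decode 1                   = zer
decode 2                   = probe
decode (suc (suc (suc n))) = alternating n

alternating-even : ∀ k → alternating (double k) ≡ host k
alternating-even zero    = refl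
alternating-even (suc k) = cong shift (alternating-even k)

alternating-odd : ∀ k → alternating (suc (double k)) ≡ sub k
alternating-odd zero    = refl
alternating-odd (suc k) = cong shift (alternating-odd k)

decode-⌜⌝ : ∀ s → decode ⌜ s ⌝ ≡ s
decode-⌜⌝ result   = refl
decode-⌜⌝ zer      = refl
decode-⌜⌝ probe    = refl
decode-⌜⌝ (host k) = alternating-even k
decode-⌜⌝ (sub k)  = alternating-odd k

parity : ∀ n → (∃[ k ] double k ≡ n) ⊎ (∃[ k ] suc (double k) ≡ n)
parity zero = inj₁ (0 , refl)
parity (suc n) with parity n
... | inj₁ (k , refl) = inj₂ (k , refl)
... | inj₂ (k , refl) = inj₁ (suc k , refl)

⌜⌝-decode : ∀ n → ⌜ decode n ⌝ ≡ n
⌜⌝-decode 0 = refl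
⌜⌝-decode 1 = refl
⌜⌝-decode 2 = refl
⌜⌝-decode (suc (suc (suc n))) with parity n
... | inj₁ (k , refl) = cong ⌜_⌝ (alternating-even k)
... | inj₂ (k , refl) = cong ⌜_⌝ (alternating-odd k)

decode-≢ : ∀ {s i} → i ≢ ⌜ s ⌝ → decode i ≢ s
decode-≢ {i = i} i≢s refl = i≢s (sym (⌜⌝-decode i))

host-injective : ∀ {i j} → host i ≡ host j → i ≡ j
host-injective refl = refl

sub-injective : ∀ {i j} → sub i ≡ sub j → i ≡ j
sub-injective refl = refl

host? : ∀ s → Dec (∃[ k ] s ≡ host k)
host? result   = no λ ()
host? zer      = no λ ()
host? probe    = no λ ()
host? (host k) = yes (k , refl)
host? (sub k)  = no λ ()

sub? : ∀ s → Dec (∃[ k ] s ≡ sub k)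
sub? result   = no λ ()
sub? zer      = no λ ()
sub? probe    = no λ ()
sub? (host k) = no λ ()
sub? (sub k)  = yes (k , refl)

at-cast : ∀ {P m n c} → m ≡ n → At P m c → At P n c
at-cast refl a = a

-- The offset is the first summand, so that `2 ℕ.+ p` computes to two successors of `p`, the form in
-- which single steps deliver line numbers.
Code : Program → ℕ → List Command → Set
Code Q p xs = ∀ {k c} → At xs k c → At Q (k ℕ.+ p) c

at-++ˡ : ∀ {xs ys k c} → At xs k c → At (xs ++ ys) k c
at-++ˡ here      = here
at-++ˡ (there a) = there (at-++ˡ a)

at-++ʳ : ∀ xs {ys k c} → At ys k c → At (xs ++ ys) (k ℕ.+ length xs) c
at-++ʳ []       {k = k} a = at-cast (sym (ℕₚ.+-identityʳ k)) a
at-++ʳ (x ∷ xs) {k = k} a = at-cast (sym (ℕₚ.+-suc k (length xs))) (there (at-++ʳ xs a))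

at-map : ∀ (f : Command → Command) {xs k c} → At xs k c → At (map f xs) k (f c)
at-map f here      = here
at-map f (there a) = there (at-map f a)

code-tail : ∀ {Q p c xs} → Code Q p (c ∷ xs) → Code Q (suc p) xs
code-tail {p = p} code {k} a = at-cast (sym (ℕₚ.+-suc k p)) (code (there a))

code-left : ∀ {Q p} xs {ys} → Code Q p (xs ++ ys) → Code Q p xs
code-left xs code a = code (at-++ˡ a)

code-right : ∀ {Q p} xs {ys} → Code Q p (xs ++ ys) → Code Q (length xs ℕ.+ p) ys
code-right {p = p} xs code {k} a =
  at-cast (ℕₚ.+-assoc k (length xs) p) (code (at-++ʳ xs a))

target : Command → ℕ
target (increment j)     = j
target (copy _ j)        = j
-- A jump writes no register. The default 0 is harmless since `register-bound` exceeds it anyway.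
target (jump-if-≡ _ _ _) = 0
target (oracle j)        = j

-- At least 2, so that the two input registers are counted as well.
register-bound : Program → ℕ
register-bound []      = 2
register-bound (c ∷ P) = suc (target c) ℕ.⊔ register-bound P

2≤register-bound : ∀ P → 2 ℕ.≤ register-bound P
2≤register-bound []      = ℕₚ.≤-refl
2≤register-bound (c ∷ P) = ℕₚ.m≤n⇒m≤o⊔n (suc (target c)) (2≤register-bound P)

target<bound : ∀ {P n c} → At P n c → target c ℕ.< register-bound P
target<bound {c ∷ P} here      = ℕₚ.m≤m⊔n (suc (target c)) (register-bound P)
target<bound {c ∷ P} (there a) = ℕₚ.m≤n⇒m≤o⊔n (suc (target c)) (target<bound a)

-- Translated commands simulate a computation with oracle `∅`, whose answers are all 0, while the
-- compiled program may run with another oracle. So a query becomes a copy of 0.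
translate : (ℕ → Slot) → (ℕ → ℕ) → Command → Command
translate ρ f (increment j)     = increment ⌜ ρ j ⌝
translate ρ f (copy i j)        = copy ⌜ ρ i ⌝ ⌜ ρ j ⌝
translate ρ f (jump-if-≡ i j l) = jump-if-≡ ⌜ ρ i ⌝ ⌜ ρ j ⌝ (f l)
translate ρ f (oracle j)        = copy ⌜ zer ⌝ ⌜ ρ j ⌝

-- `sub 0` is spared: it holds the answer of the call, and the caller clears it after use.
clear : ℕ → List Command
clear zero    = []
clear (suc k) = copy ⌜ zer ⌝ ⌜ sub (suc k) ⌝ ∷ clear k

length-clear : ∀ k → length (clear k) ≡ k
length-clear zero    = refl
length-clear (suc k) = cong suc (length-clear k)

-- Steps on slots and the inlined subroutine

module Slots {ℓ : Level} (em : ExcludedMiddle ℓ) (α : Ordinal ℓ)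
  {z : Ordinal.Carrier α} (z-zero : Ordinal.IsZero α z) where
  open Ordinal α hiding (_<_; _≤_)
  open Machine α
  open Runs em α
  open Paths em α
  private
    module α = Ordinal α
    module αₚ = OrdinalProperties α

  ≡z : ∀ {a} → IsZero a → a ≡ z
  ≡z a0 = αₚ.zero-unique a0 z-zero

  ⟪_,_⟫ : ℕ → (Slot → Carrier) → Config
  ⟪ n , σ ⟫ = record { line = n ; reg = σ ∘ decode }

  slots : (r o : Carrier) (h g : ℕ → Carrier) → Slot → Carrier
  slots r o h g result   = r
  slots r o h g zer      = z
  slots r o h g probe    = o
  slots r o h g (host k) = h k
  slots r o h g (sub k)  = g k

  cfg : ℕ → (r o : Carrier) (h g : ℕ → Carrier) → Config
  cfg n r o h g = ⟪ n , slots r o h g ⟫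

  module _ {Q : Program} {x : Subset} {n : ℕ} {σ τ : Slot → Carrier} where

    others : ∀ {b} → (∀ s → s ≢ b → τ s ≡ σ s) → OthersUnchanged ⌜ b ⌝ ⟪ n , σ ⟫ ⟪ suc n , τ ⟫
    others same i i≢b = same (decode i) (decode-≢ i≢b)

    step-copy : ∀ a b → At Q n (copy ⌜ a ⌝ ⌜ b ⌝) → τ b ≡ σ a → (∀ s → s ≢ b → τ s ≡ σ s) →
                Step Q x ⟪ n , σ ⟫ ⟪ suc n , τ ⟫
    step-copy a b at eq same = at⇒step {Q} at
      (refl , trans (cong τ (decode-⌜⌝ b)) (trans eq (cong σ (sym (decode-⌜⌝ a)))) , others same)

    step-increment : ∀ b → At Q n (increment ⌜ b ⌝) → IsSuc (σ b) (τ b) → (∀ s → s ≢ b → τ s ≡ σ s) →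
                     Step Q x ⟪ n , σ ⟫ ⟪ suc n , τ ⟫
    step-increment b at eq same = at⇒step {Q} at
      (refl , subst (λ s → IsSuc (σ s) (τ s)) (sym (decode-⌜⌝ b)) eq , others same)

    step-oracle : ∀ b → At Q n (oracle ⌜ b ⌝) → IsChar x (σ b) (τ b) → (∀ s → s ≢ b → τ s ≡ σ s) →
                  Step Q x ⟪ n , σ ⟫ ⟪ suc n , τ ⟫
    step-oracle b at eq same = at⇒step {Q} at
      (refl , subst (λ s → IsChar x (σ s) (τ s)) (sym (decode-⌜⌝ b)) eq , others same)

    step-jump : ∀ a b {l m} → At Q n (jump-if-≡ ⌜ a ⌝ ⌜ b ⌝ l) →
                (σ a ≡ σ b × m ≡ l) ⊎ (σ a ≢ σ b × m ≡ suc n) → (∀ s → τ s ≡ σ s) →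
                Step Q x ⟪ n , σ ⟫ ⟪ m , τ ⟫
    step-jump a b {l} {m} at jump same = at⇒step {Q} at
      (subst₂ (λ s s′ → (σ s ≡ σ s′ × m ≡ l) ⊎ (σ s ≢ σ s′ × m ≡ suc n))
        (sym (decode-⌜⌝ a)) (sym (decode-⌜⌝ b)) jump , λ i → same (decode i))

  -- Generic in the embedding `ρ` of registers and the relabelling `f` of lines, as it serves the
  -- called program through `sub` and the simulated one through `host`. The equation `next` makes
  -- falling through to the next line agree with `f`.
  module Translate {ρ : ℕ → Slot} (ρ-injective : ∀ {i j} → ρ i ≡ ρ j → i ≡ j)
    (ρ? : ∀ s → Dec (∃[ k ] s ≡ ρ k)) (f : ℕ → ℕ)
    {Q : Program} {x : Subset} {c d : Config} {n : ℕ} {σ τ : Slot → Carrier}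
    (next : suc n ≡ f (suc (line c)))
    (σ-zer : σ zer ≡ z) (σ≡c : ∀ k → σ (ρ k) ≡ reg c k) (τ≡d : ∀ k → τ (ρ k) ≡ reg d k)
    (unchanged : ∀ s → (∀ k → s ≢ ρ k) → τ s ≡ σ s)
    where

    translate-others : ∀ {j} → OthersUnchanged j c d → ∀ s → s ≢ ρ j → τ s ≡ σ s
    translate-others same s s≢j with ρ? s
    ... | yes (k , refl) = trans (τ≡d k) (trans (same k λ { refl → s≢j refl }) (sym (σ≡c k)))
    ... | no ∄           = unchanged s λ k eq → ∄ (k , eq)

    translate-all : (∀ k → reg d k ≡ reg c k) → ∀ s → τ s ≡ σ s
    translate-all same s with ρ? s
    ... | yes (k , refl) = trans (τ≡d k) (trans (same k) (sym (σ≡c k)))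
    ... | no ∄           = unchanged s λ k eq → ∄ (k , eq)

    to-next : line d ≡ suc (line c) → Step Q x ⟪ n , σ ⟫ ⟪ suc n , τ ⟫ → Step Q x ⟪ n , σ ⟫ ⟪ f (line d) , τ ⟫
    to-next eq = subst (λ m → Step Q x ⟪ n , σ ⟫ ⟪ m , τ ⟫) (trans next (cong f (sym eq)))

    translate-step : ∀ cmd → At Q n (translate ρ f cmd) → Exec ∅ cmd c d → Step Q x ⟪ n , σ ⟫ ⟪ f (line d) , τ ⟫
    translate-step (increment j) at (eq , v , same) = to-next eq
      (step-increment {Q} {x} (ρ j) at (subst₂ IsSuc (sym (σ≡c j)) (sym (τ≡d j)) v) (translate-others same))
    translate-step (copy i j) at (eq , v , same) = to-next eq
      (step-copy {Q} {x} (ρ i) (ρ j) at (trans (τ≡d j) (trans v (sym (σ≡c i)))) (translate-others same))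
    translate-step (jump-if-≡ i j l) at (inj₁ (v , eq) , same) =
      step-jump {Q} {x} (ρ i) (ρ j) at (inj₁ (trans (σ≡c i) (trans v (sym (σ≡c j))) , cong f eq)) (translate-all same)
    translate-step (jump-if-≡ i j l) at (inj₂ (v , eq) , same) =
      step-jump {Q} {x} (ρ i) (ρ j) at
        (inj₂ ((λ e → v (trans (sym (σ≡c i)) (trans e (σ≡c j)))) , trans (cong f eq) (sym next)))
        (translate-all same)
    translate-step (oracle j) at (eq , inj₂ (_ , v) , same) = to-next eq
      (step-copy {Q} {x} zer (ρ j) at (trans (τ≡d j) (trans (≡z v) (sym σ-zer))) (translate-others same))

  -- What surrounding limits need to know about a call: it never goes back before `p` and leaves the
  -- host registers alone. Stating this through `decode i` fits case distinctions on the slot of a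
  -- register.
  At-least : ℕ → (ℕ → Carrier) → Pred Config ℓ
  At-least p h c = p ℕ.≤ line c × (∀ i k → decode i ≡ host k → reg c i ≡ h k)

  at-least : ∀ {p n r o h g} → p ℕ.≤ n → At-least p h (cfg n r o h g)
  at-least {r = r} {o} {h} {g} p≤n = p≤n , λ i k → cong (slots r o h g)

  override : ℕ → Carrier → (ℕ → Carrier) → ℕ → Carrier
  override j v h k with k ℕₚ.≟ j
  ... | yes _ = v
  ... | no _  = h k

  override-≡ : ∀ j {v h} → override j v h j ≡ v
  override-≡ j with j ℕₚ.≟ j
  ... | yes _  = refl
  ... | no j≢j = contradiction refl j≢j

  override-≢ : ∀ {j v h k} → k ≢ j → override j v h k ≡ h k
  override-≢ {j} {k = k} k≢j with k ℕₚ.≟ j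
  ... | yes k≡j = contradiction k≡j k≢j
  ... | no _    = refl

  end-at : ∀ {Q x I c m n r o h g} → m ≡ n → Path Q x I c (cfg m r o h g) → Path Q x I c (cfg n r o h g)
  end-at refl p = p

  -- Clearing proceeds downwards from register `k`, so everything above the counter is already 0.
  -- When a call starts to clear, this holds because no register from `bound` on has been written.
  clear-path : ∀ {Q x c p₀ p r o h} k (g : ℕ → Carrier) → p₀ ℕ.≤ p → Code Q p (clear k) →
               (∀ i → k ℕ.< i → g i ≡ z) → Path Q x (At-least p₀ h) c (cfg p r o h g) →
               ∃[ g′ ] g′ 0 ≡ g 0 × (∀ i → g′ (suc i) ≡ z) ×
                       Path Q x (At-least p₀ h) c (cfg (k ℕ.+ p) r o h g′)
  clear-path zero g p₀≤p code g≡z path = g , refl , (λ i → g≡z (suc i) (ℕ.s≤s ℕ.z≤n)) , path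
  clear-path {Q} {x} {p₀ = p₀} {p} {r} {o} {h} (suc k) g p₀≤p code g≡z path
    with clear-path {Q} {x} {p₀ = p₀} {suc p} {r} {o} {h} k (override (suc k) z g) p₀≤1+p (code-tail {Q} code) g≡z′
           (path ▷⟨ step-copy {Q} {x} zer (sub (suc k)) (code here) (override-≡ (suc k) {h = g}) kept ⟩ at-least p₀≤1+p)
    where
    p₀≤1+p = ℕₚ.m≤n⇒m≤1+n p₀≤p
    g≡z′ : ∀ i → k ℕ.< i → override (suc k) z g i ≡ z
    g≡z′ i k<i with i ℕₚ.≟ suc k
    ... | yes _ = refl
    ... | no i≢ = g≡z i (ℕₚ.≤∧≢⇒< k<i (i≢ ∘ sym))
    kept : ∀ s → s ≢ sub (suc k) → slots r o h (override (suc k) z g) s ≡ slots r o h g s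
    kept result   _ = refl
    kept zer      _ = refl
    kept probe    _ = refl
    kept (host _) _ = refl
    kept (sub i)  ≢ = override-≢ {h = g} λ { refl → ≢ refl }
  ... | g′ , g′0 , g′suc , path′ = g′ , g′0 , g′suc , end-at (ℕₚ.+-suc k p) path′

  module Subroutine (C : Program) where
    len = length C
    bound = register-bound C

    -- The cut-off sends every halting line, however far beyond the end, to the first line after the
    -- inlined code.
    local-line : ℕ → ℕ → ℕ
    local-line p l = l ℕ.⊓ len ℕ.+ p

    inline : ℕ → List Command
    inline p = map (translate sub (local-line p)) C

    call : ℕ → ℕ → List Command
    call q p = copy ⌜ host q ⌝ ⌜ sub 0 ⌝ ∷ inline (suc p) ++ clear bound

    call-length : ℕ
    call-length = suc (len ℕ.+ bound)

    length-call : ∀ q p → length (call q p) ≡ call-length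
    length-call q p = cong suc (trans (length-++ (inline (suc p)))
      (cong₂ ℕ._+_ (length-map _ C) (length-clear bound)))

    exec-unchanged : ∀ {x} cmd {c d i} → i ≢ target cmd → Exec x cmd c d → reg d i ≡ reg c i
    exec-unchanged (increment j)     i≢j (_ , _ , same) = same _ i≢j
    exec-unchanged (copy _ j)        i≢j (_ , _ , same) = same _ i≢j
    exec-unchanged (jump-if-≡ _ _ _) _   (_ , same)     = same _
    exec-unchanged (oracle j)        i≢j (_ , _ , same) = same _ i≢j

    module _ {ι} (ρ : HaltingRun C ∅ (ι ∷ z ∷ [])) where
      open RunProperties ρ renaming (Carrier to Carrierᵀ; IsSuc to IsSucᵀ)
      open Prefix ρ using (first; first-zero)

      unused-zero : ∀ {i} → bound ℕ.≤ i → ∀ t → Acc _<_ t → reg (conf t) i ≡ z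
      unused-zero {i} b≤i t (acc rs) with Timeᶜ.kind t
      ... | Timeᶜ.is-zero t0 with i | ℕₚ.≤-trans (2≤register-bound C) b≤i
      ...   | suc (suc k) | _ = ≡z (proj₂ (proj₂ (initial-regs t t0)) k)
      ...   | suc zero    | ℕ.s≤s ()
      unused-zero {i} b≤i t (acc rs) | Timeᶜ.is-suc s st with step⇒at {C} (successor s t st)
      ...   | cmd , at , exec = trans
        (exec-unchanged cmd (ℕₚ.>⇒≢ (ℕₚ.<-≤-trans (target<bound at) b≤i)) exec)
        (unused-zero b≤i s (rs (proj₁ st)))
      unused-zero {i} b≤i t (acc rs) | Timeᶜ.is-limit t-lim = sup-unique αₚ.≤-antisym
        (limit-regs t t-lim i)
        (Regs.liminf-const time _ (Time.zero<limit first-zero t-lim) λ s s<t → unused-zero b≤i s (rs s<t))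

      -- Each command becomes exactly one command, so the clock of the called run is kept as it is.
      -- Limits of lines survive because `local-line` is monotone.
      inline-path : ∀ {Q x p₀ p r o h} → p₀ ℕ.≤ p → Code Q p (inline p) →
                    Path Q x (At-least p₀ h) (cfg p r o h (reg (conf first))) (cfg (len ℕ.+ p) r o h (reg (conf end)))
      inline-path {Q} {x} {p₀} {p} {r} {o} {h} p₀≤p code = record
        { time       = time
        ; conf       = conf′
        ; first      = first
        ; first-zero = first-zero
        ; conf-first = cong (λ l → cfg (local-line p l) r o h (reg (conf first))) (initial-line first first-zero)
        ; last       = end
        ; last-max   = end-last
        ; conf-last  = cong (λ n → cfg (n ℕ.+ p) r o h (reg (conf end))) (ℕₚ.m≥n⇒m⊓n≡n end-halted)
        ; successor  = step′
        ; limit      = λ l l-lim →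
            let first<l = Time.zero<limit first-zero l-lim in
            Lines.liminf-mono time (first , first<l) (local-line p)
              (λ i≤j → ℕₚ.+-monoˡ-≤ p (ℕₚ.⊓-monoˡ-≤ len i≤j)) (limit-line l l-lim) ,
            λ j → limit′ first<l (limit-regs l l-lim) (decode j)
        ; invariant  = λ t → at-least (ℕₚ.m≤n⇒m≤o+n (line (conf t) ℕ.⊓ len) p₀≤p)
        }
        where
        σ : Carrierᵀ → Slot → Carrier
        σ t = slots r o h (reg (conf t))
        conf′ : Carrierᵀ → Config
        conf′ t = ⟪ local-line p (line (conf t)) , σ t ⟫
        step′ : ∀ s t → IsSucᵀ s t → Step Q x (conf′ s) (conf′ t)
        step′ s t st with step⇒at {C} (successor s t st)
        ... | cmd , at , exec = translate-step cmd at′ exec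
          where
          line< : line (conf s) ℕ.< len
          line< = at-< at
          local : line (conf s) ℕ.+ p ≡ local-line p (line (conf s))
          local = cong (ℕ._+ p) (sym (ℕₚ.m≤n⇒m⊓n≡m (ℕₚ.<⇒≤ line<)))
          at′ : At Q (local-line p (line (conf s))) (translate sub (local-line p) cmd)
          at′ = at-cast local (code (at-map (translate sub (local-line p)) at))
          subs-only : ∀ u → (∀ k → u ≢ sub k) → σ t u ≡ σ s u
          subs-only result   _ = refl
          subs-only zer      _ = refl
          subs-only probe    _ = refl
          subs-only (host _) _ = refl
          subs-only (sub k)  ≢ = contradiction refl (≢ k)
          open Translate sub-injective sub? (local-line p) {Q} {x} {conf s} {conf t}
            {local-line p (line (conf s))} {σ s} {σ t}
            -- An active line and its successor are both at most `len`, so the cut-off leaves them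
            -- unchanged.
            (trans (cong suc (sym local)) (cong (ℕ._+ p) (sym (ℕₚ.m≤n⇒m⊓n≡m line<))))
            refl (λ _ → refl) (λ _ → refl)
            subs-only
        limit′ : ∀ {l} → first < l → (∀ j → IsLiminf α._≤_ time (λ t → reg (conf t) j) l (reg (conf l) j)) →
                 ∀ s → IsLiminf α._≤_ time (λ t → σ t s) l (σ l s)
        limit′ first<l lim result   = Regs.liminf-const time _ first<l λ _ _ → refl
        limit′ first<l lim zer      = Regs.liminf-const time _ first<l λ _ _ → refl
        limit′ first<l lim probe    = Regs.liminf-const time _ first<l λ _ _ → refl
        limit′ first<l lim (host k) = Regs.liminf-const time _ first<l λ _ _ → refl
        limit′ first<l lim (sub k)  = lim k

-- Calls and block-by-block simulation

module Simulation {ℓ : Level} (em : ExcludedMiddle ℓ) (α : Ordinal ℓ)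
  {z : Ordinal.Carrier α} (z-zero : Ordinal.IsZero α z) where
  open Ordinal α hiding (_<_; _≤_; wellFounded)
  open Machine α
  open Runs em α
  open Paths em α
  open Slots em α z-zero
  private
    module α = Ordinal α

  module Call (C : Program) where
    open Subroutine C

    call-path : ∀ {Q x p₀ p r o h} q → p₀ ℕ.≤ p → Code Q p (call q p) →
                (ρ : HaltingRun C ∅ (h q ∷ z ∷ [])) →
                ∃[ g ] g 0 ≡ HaltingRun.output ρ × (∀ i → g (suc i) ≡ z) ×
                       Path Q x (At-least p₀ h) (cfg p r o h (λ _ → z)) (cfg (call-length ℕ.+ p) r o h g)
    call-path {Q} {x} {p₀} {p} {r} {o} {h} q p₀≤p code ρ =
      let g , g0 , gsuc , path = clear-path {Q} {x} bound (reg (conf end)) (ℕₚ.m≤n⇒m≤o+n len p₀≤1+p)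
            clear-code
            (λ i bound<i → unused-zero ρ (ℕₚ.<⇒≤ bound<i) end (wellFounded end))
            (append (singleton _ (at-least p₀≤p))
              (step-copy {Q} {x} (host q) (sub 0) (code here) (proj₁ initial) kept)
              (inline-path ρ {Q} {x} p₀≤1+p (code-left {Q} (inline (suc p)) (code-tail {Q} code))))
      in g , g0 , gsuc , end-at end-line path
      where
      open RunProperties ρ using (conf; end; wellFounded; initial-regs)
      open Prefix ρ using (first; first-zero)
      p₀≤1+p = ℕₚ.m≤n⇒m≤1+n p₀≤p
      clear-code : Code Q (len ℕ.+ suc p) (clear bound)
      clear-code {k} at = at-cast
        (cong (λ n → k ℕ.+ (n ℕ.+ suc p)) (length-map (translate sub (local-line (suc p))) C))
        (code-right {Q} (inline (suc p)) (code-tail {Q} code) at)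
      initial : InitialRegs (h q ∷ z ∷ []) (reg (conf first))
      initial = initial-regs first first-zero
      kept : ∀ s → s ≢ sub 0 → slots r o h (reg (conf first)) s ≡ slots r o h (λ _ → z) s
      kept result              _ = refl
      kept zer                 _ = refl
      kept probe               _ = refl
      kept (host _)            _ = refl
      kept (sub zero)          ≢ = contradiction refl ≢
      -- The called program expects the parameter 0 in its register 1; the cleared register supplies
      -- it.
      kept (sub (suc zero))    _ = proj₁ (proj₂ initial)
      kept (sub (suc (suc k))) _ = ≡z (proj₂ (proj₂ initial) k)
      end-line : bound ℕ.+ (len ℕ.+ suc p) ≡ call-length ℕ.+ p
      end-line = begin
        bound ℕ.+ (len ℕ.+ suc p)   ≡⟨ ℕₚ.+-assoc bound len (suc p) ⟨
        bound ℕ.+ len ℕ.+ suc p     ≡⟨ cong (ℕ._+ suc p) (ℕₚ.+-comm bound len) ⟩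
        len ℕ.+ bound ℕ.+ suc p     ≡⟨ ℕₚ.+-suc (len ℕ.+ bound) p ⟩
        call-length ℕ.+ p           ∎
        where open ≡-Reasoning

  -- n is the number of lines of the simulated program, and every line becomes
  -- a block of L commands. Line numbers are cut off at n since a program may
  -- jump far beyond its last line.
  module Host (n L : ℕ) where

    host-line : ℕ → ℕ
    host-line l = (l ℕ.⊓ n) ℕ.* L

    host-line-mono : ∀ {i j} → i ℕ.≤ j → host-line i ℕ.≤ host-line j
    host-line-mono i≤j = ℕₚ.*-monoˡ-≤ L (ℕₚ.⊓-monoˡ-≤ n i≤j)

    host-line-≤ : ∀ {l} → l ℕ.≤ n → host-line l ≡ l ℕ.* L
    host-line-≤ l≤n = cong (ℕ._* L) (ℕₚ.m≤n⇒m⊓n≡m l≤n)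

    host-line-≥ : ∀ {l} → n ℕ.≤ l → host-line l ≡ n ℕ.* L
    host-line-≥ n≤l = cong (ℕ._* L) (ℕₚ.m≥n⇒m⊓n≡n n≤l)

    ⟦_⟧ : Config → Config
    ⟦ c ⟧ = cfg (host-line (line c)) z z (reg c) (λ _ → z)

    Hosting : (ℕ → Carrier) → Pred Config ℓ
    Hosting h c = ∀ i k → decode i ≡ host k → reg c i ≡ h k

    -- The disjunction tells whether the host update has already happened. In both cases the host
    -- registers are those at the start of this block or of the next.
    Between : Config → Config → Pred Config ℓ
    Between c d e = host-line (line c) ℕ.≤ line e × (Hosting (reg c) e ⊎ Hosting (reg d) e)

    -- The last command of the block is kept apart as `step` because `Concat` joins its pieces by
    -- single steps.
    record Transition (Q : Program) (x : Subset) (V : Pred Config ℓ) (c d : Config) : Set (lsuc ℓ) where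
      field
        {stop} : Config
        path   : Path Q x (Between c d) ⟦ c ⟧ stop
        step   : Step Q x stop ⟦ d ⟧
        visit  : ∃[ t ] V (Path.conf path t)

    -- `final` takes the place of a block at the last time: it is trivial for the search, and for
    -- the recognizer it ends in the increment that accepts or in the jump that rejects.
    module Simulate {P Q x y c d} (hp : Path P y U c d)
      (V : Path.Carrier hp → Pred Config ℓ)
      (transition : ∀ s t → Path.IsSuc hp s t → Transition Q x (V s) (Path.conf hp s) (Path.conf hp t))
      {e} (final : Path Q x (Between (Path.conf hp (Path.last hp)) (Path.conf hp (Path.last hp)))
                            ⟦ Path.conf hp (Path.last hp) ⟧ e)
      where
      private
        module H = Path hp
        module Hₚ = OrdinalProperties H.time
        module Hᶜ = Hₚ.Classical em

      -- `Between` mentions the next configuration, which does not exist at the last time. Naming a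
      -- time `t′` instead covers both cases.
      Segment-invariant : H.Carrier → Pred Config ℓ
      Segment-invariant t e = host-line (line (H.conf t)) ℕ.≤ line e ×
        (∃[ t′ ] (t′ ≡ t ⊎ H.IsSuc t t′) × Hosting (reg (H.conf t′)) e)

      record Segment (t : H.Carrier) : Set (lsuc ℓ) where
        field
          {stop}    : Config
          path      : Path Q x (Segment-invariant t) ⟦ H.conf t ⟧ stop
          step      : ∀ t⁺ → H.IsSuc t t⁺ → Step Q x stop ⟦ H.conf t⁺ ⟧
          visit     : t H.< H.last → ∃[ b ] V t (Path.conf path b)
          stop-last : t ≡ H.last → stop ≡ e

      segment : ∀ t → Segment t
      segment t with H.last-max t
      ... | inj₁ t<last =
        let t⁺ , suc-t , _ = Hᶜ.suc-exists t<last
            tr = transition t t⁺ suc-t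
        in record
          { path      = weaken (λ { (low , inj₁ hosting) → low , t , inj₁ refl , hosting
                                  ; (low , inj₂ hosting) → low , t⁺ , inj₂ suc-t , hosting }) (Transition.path tr)
          ; step      = λ u suc-u → subst (λ v → Step Q x _ ⟦ H.conf v ⟧) (Hₚ.suc-unique suc-t suc-u) (Transition.step tr)
          ; visit     = λ _ → Transition.visit tr
          ; stop-last = λ { refl → contradiction t<last Hₚ.<-irrefl }
          }
      ... | inj₂ refl = record
        { path      = weaken (λ { (low , inj₁ hosting) → low , t , inj₁ refl , hosting
                                ; (low , inj₂ hosting) → low , t , inj₁ refl , hosting }) final
        ; step      = λ t⁺ suc-t → contradiction (proj₁ suc-t) (Hₚ.≤⇒≯ (H.last-max t⁺))
        ; visit     = λ last<last → contradiction last<last Hₚ.<-irrefl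
        ; stop-last = λ _ → refl
        }

      private
        module S t = Segment (segment t)

      start-limit : ∀ l → H.IsLimit l → IsLiminfConfig H.time (λ t → ⟦ H.conf t ⟧) l ⟦ H.conf l ⟧
      start-limit l l-lim =
        Lines.liminf-mono H.time (H.first , first<l) host-line host-line-mono (proj₁ (H.limit l l-lim)) ,
        λ j → by-slot (decode j)
        where
        first<l = Hₚ.zero<limit H.first-zero l-lim
        σ : H.Carrier → Slot → Carrier
        σ t = slots z z (reg (H.conf t)) (λ _ → z)
        by-slot : ∀ s → IsLiminf α._≤_ H.time (λ t → σ t s) l (σ l s)
        by-slot result   = Regs.liminf-const H.time _ first<l λ _ _ → refl
        by-slot zer      = Regs.liminf-const H.time _ first<l λ _ _ → refl
        by-slot probe    = Regs.liminf-const H.time _ first<l λ _ _ → refl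
        by-slot (sub k)  = Regs.liminf-const H.time _ first<l λ _ _ → refl
        by-slot (host k) = proj₂ (H.limit l l-lim) k

      -- Registers other than hosts are 0 at the start of every block, hence below any content. Host
      -- registers have their values at `t′`, which is still below the limit even if it is the
      -- successor of `t`.
      reg-low : ∀ l → H.IsLimit l → ∀ t e j → t H.< l → Segment-invariant t e →
                ∃[ t′ ] t H.≤ t′ × t′ H.< l × reg ⟦ H.conf t′ ⟧ j α.≤ reg e j
      reg-low l l-lim t e j t<l (_ , t′ , t′-next , hosting) = by-slot (decode j) refl
        where
        σ : H.Carrier → Slot → Carrier
        σ t = slots z z (reg (H.conf t)) (λ _ → z)
        t≤t′ : t′ ≡ t ⊎ H.IsSuc t t′ → t H.≤ t′
        t≤t′ (inj₁ t′≡t)  = inj₂ (sym t′≡t)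
        t≤t′ (inj₂ suc-t) = inj₁ (proj₁ suc-t)
        t′<l : t′ ≡ t ⊎ H.IsSuc t t′ → t′ H.< l
        t′<l (inj₁ refl)  = t<l
        t′<l (inj₂ suc-t) = Hₚ.suc<limit suc-t l-lim t<l
        low : ∀ {s} → decode j ≡ s → σ t s ≡ z → ∃[ t′ ] t H.≤ t′ × t′ H.< l × σ t′ (decode j) α.≤ reg e j
        low refl eq = t , Hₚ.≤-refl , t<l , subst (α._≤ reg e j) (sym eq) (z-zero _)
        by-slot : ∀ s → decode j ≡ s → ∃[ t′ ] t H.≤ t′ × t′ H.< l × σ t′ (decode j) α.≤ reg e j
        by-slot result   eq = low eq refl
        by-slot zer      eq = low eq refl
        by-slot probe    eq = low eq refl
        by-slot (sub k)  eq = low eq refl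
        by-slot (host k) eq = t′ , t≤t′ t′-next , t′<l t′-next ,
          inj₂ (trans (cong (σ t′) eq) (sym (hosting j k eq)))

      open Concat H.time {J = U} (λ _ _ → tt) (λ t → ⟦ H.conf t ⟧) S.stop S.path
        (λ s t → S.step s t) start-limit
        (λ l _ t e t<l inv → t , Hₚ.≤-refl , t<l , proj₁ inv) reg-low

      simulation : Path Q x U ⟦ H.conf H.first ⟧ e
      simulation = record
        { Path (concat H.first-zero H.last-max) hiding (conf-last)
        ; conf-last = trans (Path.conf-last (concat H.first-zero H.last-max)) (S.stop-last H.last refl)
        }

      simulation-visit : ∀ t → t H.< H.last →
        ∃[ τ ] Path._<_ simulation τ (Path.last simulation) × V t (Path.conf simulation τ)
      simulation-visit t t<last = let b , visited = S.visit t t<last in (t , b) , ∑.left t<last , visited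

-- Assembling blocks of equal length

module Blocks (block : ℕ → Command → List Command) (L : ℕ)
  (length-block : ∀ p c → length (block p c) ≡ L) (epilogue : List Command) where

  -- The counter `i` is the line in the whole simulated program: jumps are absolute, so a block
  -- depends on where it is placed.
  compile-from : ℕ → Program → Program
  compile-from i []      = epilogue
  compile-from i (c ∷ P) = block (i ℕ.* L) c ++ compile-from (suc i) P

  compile : Program → Program
  compile = compile-from 0

  private
    at-later : ∀ i c {Q k a} → At Q k a → ∀ m l → k ≡ m ℕ.+ l →
               At (block (i ℕ.* L) c ++ Q) (m ℕ.+ (L ℕ.+ l)) a
    at-later i c at m l refl = at-cast eq (at-++ʳ (block (i ℕ.* L) c) at)
      where
      eq : m ℕ.+ l ℕ.+ length (block (i ℕ.* L) c) ≡ m ℕ.+ (L ℕ.+ l)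
      eq rewrite length-block (i ℕ.* L) c = trans (ℕₚ.+-assoc m l L) (cong (m ℕ.+_) (ℕₚ.+-comm l L))

  at-block : ∀ {P i c m a} k → At P i c → At (block ((i ℕ.+ k) ℕ.* L) c) m a →
             At (compile-from k P) (m ℕ.+ i ℕ.* L) a
  at-block {m = m} k here a = at-cast (sym (ℕₚ.+-identityʳ m)) (at-++ˡ a)
  at-block {b ∷ P} {suc i} {c} {m} {a} k (there at) at′ = at-later k b
    (at-block (suc k) at (subst (λ j → At (block (j ℕ.* L) c) m a) (sym (ℕₚ.+-suc i k)) at′)) m (i ℕ.* L) refl

  code-block : ∀ {P i c} → At P i c → Code (compile P) (i ℕ.* L) (block (i ℕ.* L) c)
  code-block {i = i} {c} at {m} {a} at′ =
    at-block 0 at (subst (λ j → At (block (j ℕ.* L) c) m a) (sym (ℕₚ.+-identityʳ i)) at′)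

  at-epilogue : ∀ k P {m a} → At epilogue m a → At (compile-from k P) (m ℕ.+ length P ℕ.* L) a
  at-epilogue k []      {m} at = at-cast (sym (ℕₚ.+-identityʳ m)) at
  at-epilogue k (c ∷ P) {m} at = at-later k c (at-epilogue (suc k) P at) m (length P ℕ.* L) refl

  length-compile : ∀ k P → length (compile-from k P) ≡ length P ℕ.* L ℕ.+ length epilogue
  length-compile k []      = refl
  length-compile k (c ∷ P) = begin
    length (block (k ℕ.* L) c ++ compile-from (suc k) P)
      ≡⟨ length-++ (block (k ℕ.* L) c) ⟩
    length (block (k ℕ.* L) c) ℕ.+ length (compile-from (suc k) P)
      ≡⟨ cong₂ ℕ._+_ (length-block _ c) (length-compile (suc k) P) ⟩
    L ℕ.+ (length P ℕ.* L ℕ.+ length epilogue)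
      ≡⟨ ℕₚ.+-assoc L (length P ℕ.* L) (length epilogue) ⟨
    length (c ∷ P) ℕ.* L ℕ.+ length epilogue ∎
    where open ≡-Reasoning

-- Common properties of compiled programs, and the searcher

module Programs {ℓ : Level} (em : ExcludedMiddle ℓ) (α : Ordinal ℓ)
  {z : Ordinal.Carrier α} (z-zero : Ordinal.IsZero α z) where
  open Ordinal α hiding (_<_; _≤_; wellFounded)
  open Machine α
  open Runs em α
  open Paths em α
  open Slots em α z-zero
  open Simulation em α z-zero
  probe-only : ∀ r o o′ h g s → s ≢ probe → slots r o′ h g s ≡ slots r o h g s
  probe-only r o o′ h g result   _ = refl
  probe-only r o o′ h g zer      _ = refl
  probe-only r o o′ h g probe    ≢ = contradiction refl ≢
  probe-only r o o′ h g (host _) _ = refl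
  probe-only r o o′ h g (sub _)  _ = refl

  result-only : ∀ r r′ o h g s → s ≢ result → slots r′ o h g s ≡ slots r o h g s
  result-only r r′ o h g result   ≢ = contradiction refl ≢
  result-only r r′ o h g zer      _ = refl
  result-only r r′ o h g probe    _ = refl
  result-only r r′ o h g (host _) _ = refl
  result-only r r′ o h g (sub _)  _ = refl

  host-only : ∀ r o h h′ g j → (∀ i → i ≢ j → h′ i ≡ h i) →
              ∀ s → s ≢ host j → slots r o h′ g s ≡ slots r o h g s
  host-only r o h h′ g j same result   _ = refl
  host-only r o h h′ g j same zer      _ = refl
  host-only r o h h′ g j same probe    _ = refl
  host-only r o h h′ g j same (host i) ≢ = same i λ { refl → ≢ refl }
  host-only r o h h′ g j same (sub _)  _ = refl

  sub0-only : ∀ r o h g → (∀ i → g (suc i) ≡ z) → ∀ s → s ≢ sub 0 →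
              slots r o h (λ _ → z) s ≡ slots r o h g s
  sub0-only r o h g gsuc result        _ = refl
  sub0-only r o h g gsuc zer           _ = refl
  sub0-only r o h g gsuc probe         _ = refl
  sub0-only r o h g gsuc (host _)      _ = refl
  sub0-only r o h g gsuc (sub zero)    ≢ = contradiction refl ≢
  sub0-only r o h g gsuc (sub (suc k)) _ = sym (gsuc k)

  hosts-only : ∀ r o h h′ g s → (∀ k → s ≢ host k) → slots r o h′ g s ≡ slots r o h g s
  hosts-only r o h h′ g result   _ = refl
  hosts-only r o h h′ g zer      _ = refl
  hosts-only r o h h′ g probe    _ = refl
  hosts-only r o h h′ g (host k) ≢ = contradiction refl (≢ k)
  hosts-only r o h h′ g (sub k)  _ = refl

  -- `t` is the number of commands that follow the call in each block: 4 in the searcher and 7 in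
  -- the recognizer.
  module Compiled (C H : Program) (t : ℕ) where
    open Subroutine C
    open Call C
    open Host (length H) (t ℕ.+ call-length) public
    L = t ℕ.+ call-length

    host-next : ∀ {l} → l ℕ.< length H → t ℕ.+ (call-length ℕ.+ host-line l) ≡ host-line (suc l)
    host-next {l} l< = begin
      t ℕ.+ (call-length ℕ.+ host-line l) ≡⟨ ℕₚ.+-assoc t call-length (host-line l) ⟨
      L ℕ.+ host-line l                   ≡⟨ cong (L ℕ.+_) (host-line-≤ (ℕₚ.<⇒≤ l<)) ⟩
      suc l ℕ.* L                         ≡⟨ host-line-≤ l< ⟨
      host-line (suc l)                   ∎
      where open ≡-Reasoning

    initial-line-⟦⟧ : ∀ {c} → line c ≡ 0 → line ⟦ c ⟧ ≡ 0
    initial-line-⟦⟧ eq = cong host-line eq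

    initial-regs-⟦⟧ : ∀ {c} → InitialRegs (z ∷ []) (reg c) → InitialRegs (z ∷ []) (reg ⟦ c ⟧)
    initial-regs-⟦⟧ {c} (c0 , csuc) = refl , λ i → by-slot (decode (suc i))
      where
      by-slot : ∀ s → IsZero (slots z z (reg c) (λ _ → z) s)
      by-slot result         = z-zero
      by-slot zer            = z-zero
      by-slot probe          = z-zero
      by-slot (sub _)        = z-zero
      by-slot (host zero)    = subst IsZero (sym c0) z-zero
      by-slot (host (suc k)) = csuc k

    hosting : ∀ n r o h g → Hosting h (cfg n r o h g)
    hosting n r o h g i k = cong (slots r o h g)

    record Called (Q : Program) (x : Subset) (c d : Config) (v : Carrier) : Set (lsuc ℓ) where
      field
        g       : ℕ → Carrier
        g-value : g 0 ≡ v
        g-suc   : ∀ i → g (suc i) ≡ z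
        path    : Path Q x (Between c d) ⟦ c ⟧ (cfg (call-length ℕ.+ host-line (line c)) z z (reg c) g)

    module _ {Q : Program} {c : Config} (q : ℕ) (tail : List Command)
      (code : Code Q (host-line (line c)) (call q (host-line (line c)) ++ tail)) where

      called : ∀ {x d v} → C ^ ∅ [ reg c q ∷ z ∷ [] ]↓= v → Called Q x c d v
      called {x} (ρ , output≡v) =
        let g , g-value , g-suc , path = call-path {Q} {x} {host-line (line c)} {r = z} {z} {reg c} q
              ℕₚ.≤-refl (code-left {Q} (call q (host-line (line c))) code) ρ
        in record
          { g       = g
          ; g-value = trans g-value output≡v
          ; g-suc   = g-suc
          ; path    = weaken (λ (low , hosting) → low , inj₁ hosting) path
          }

      code-after-call : Code Q (call-length ℕ.+ host-line (line c)) tail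
      code-after-call = subst (λ n → Code Q (n ℕ.+ host-line (line c)) tail) (length-call q (host-line (line c)))
        (code-right {Q} (call q (host-line (line c))) code)

    after-call : ∀ l k → host-line l ℕ.≤ k ℕ.+ (call-length ℕ.+ host-line l)
    after-call l k = ℕₚ.m≤n⇒m≤o+n k (ℕₚ.m≤n+m _ call-length)

  module SearchProgram (C P : Program) where
    open Subroutine C
    open Compiled C P 4

    queried : Command → ℕ
    queried (oracle j) = j
    -- Other commands make a call too, whose answer is discarded, so that all blocks have the same
    -- length.
    queried _          = 0

    -- The repeated command only pads the block to the length of an oracle block.
    plain-tail : Command → List Command
    plain-tail cmd =
      copy ⌜ zer ⌝ ⌜ result ⌝ ∷ copy ⌜ zer ⌝ ⌜ result ⌝ ∷ copy ⌜ zer ⌝ ⌜ sub 0 ⌝ ∷ translate host host-line cmd ∷ []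

    tail : Command → List Command
    tail (oracle j) =
      -- The query is displayed before the answer overwrites `host j`, and `result` returns to 0 so
      -- that only hosts are nonzero between blocks.
      copy ⌜ host j ⌝ ⌜ result ⌝ ∷ copy ⌜ sub 0 ⌝ ⌜ host j ⌝ ∷ copy ⌜ zer ⌝ ⌜ sub 0 ⌝ ∷ copy ⌜ zer ⌝ ⌜ result ⌝ ∷ []
    tail cmd        = plain-tail cmd

    length-tail : ∀ cmd → length (tail cmd) ≡ 4
    length-tail (increment _)     = refl
    length-tail (copy _ _)        = refl
    length-tail (jump-if-≡ _ _ _) = refl
    length-tail (oracle _)        = refl

    block : ℕ → Command → List Command
    block p cmd = call (queried cmd) p ++ tail cmd

    length-block : ∀ p cmd → length (block p cmd) ≡ L
    length-block p cmd = trans (length-++ (call (queried cmd) p))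
      (trans (cong₂ ℕ._+_ (length-call (queried cmd) p) (length-tail cmd)) (ℕₚ.+-comm call-length 4))

    open Blocks block L length-block []

    searcher : Program
    searcher = compile P

    -- Quantifying over `j` makes this vacuous at commands that are not queries, so every block
    -- satisfies it.
    Displays : Config → Pred Config ℓ
    Displays c e = ∀ j → At P (line c) (oracle j) → reg e 0 ≡ reg c j

    module _ {c d : Config} {cmd : Command} (at : At P (line c) cmd) where
      private
        p₂ = call-length ℕ.+ host-line (line c)
        h  = reg c
        h′ = reg d

      code : Code searcher (host-line (line c)) (block (host-line (line c)) cmd)
      code = subst (λ p → Code searcher p (block p cmd)) (sym (host-line-≤ (ℕₚ.<⇒≤ (at-< at)))) (code-block at)

      plain-transition : ∀ {v} → Called searcher ∅ c d v → Code searcher p₂ (plain-tail cmd) →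
                         (∀ j → cmd ≢ oracle j) → Exec ∅ cmd c d → Transition searcher ∅ (Displays c) c d
      plain-transition call₀ code₀ not-oracle exec = record
        { path  = path
            ▷⟨ step-copy {searcher} zer result (code₀ here) refl (result-only z z z h g) ⟩
              (after-call (line c) 1 , inj₁ (hosting (1 ℕ.+ p₂) z z h g))
            ▷⟨ step-copy {searcher} zer result (code₁ here) refl (result-only z z z h g) ⟩
              (after-call (line c) 2 , inj₁ (hosting (2 ℕ.+ p₂) z z h g))
            ▷⟨ step-copy {searcher} zer (sub 0) (code₂ here) refl (sub0-only z z h g g-suc) ⟩
              (after-call (line c) 3 , inj₁ (hosting (3 ℕ.+ p₂) z z h (λ _ → z)))
        ; step  = Translate.translate-step host-injective host? host-line (host-next (at-< at))
                    refl (λ _ → refl) (λ _ → refl) (hosts-only z z h h′ (λ _ → z)) cmd (code₃ here) exec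
        -- Any time will do here; each `one` selects the left part of one of the three appended
        -- steps.
        ; visit = (one , one , one , Path.first path) , λ j at′ → contradiction (at-unique at at′) (not-oracle j)
        }
        where
        open Called call₀
        code₁ = code-tail {searcher} code₀
        code₂ = code-tail {searcher} code₁
        code₃ = code-tail {searcher} code₂

    oracle-transition : ∀ {x c d j v} (at : At P (line c) (oracle j)) → IsChar x (reg c j) v →
                        Called searcher ∅ c d v → Exec x (oracle j) c d →
                        Transition searcher ∅ (Displays c) c d
    oracle-transition {x} {c} {d} {j} {v} at char call₀ (line-d , char′ , same) = record
      { path  = append path display rest
      ; step  = subst (λ n → Step searcher ∅ (cfg (3 ℕ.+ p₂) ι z h′ (λ _ → z)) (cfg n z z h′ (λ _ → z)))
                  (trans (host-next (at-< at)) (cong host-line (sym line-d)))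
                  (step-copy {searcher} {n = 3 ℕ.+ p₂} zer result (code₃ here) refl (result-only ι z z h′ (λ _ → z)))
      ; visit = let t , t-displays = append-visits path display rest in t , λ j′ at′ →
                  trans (cong (λ e → reg e 0) t-displays) (cong (reg c) (oracle-injective (at-unique at at′)))
      }
      where
      open Called call₀
      p₂ = call-length ℕ.+ host-line (line c)
      h = reg c
      h′ = reg d
      ι = reg c j
      code₀ = code-after-call {searcher} {c} j (tail (oracle j)) (code {c} {d} at)
      code₁ = code-tail {searcher} code₀
      code₂ = code-tail {searcher} code₁
      code₃ = code-tail {searcher} code₂
      oracle-injective : ∀ {i j} → Command.oracle i ≡ oracle j → i ≡ j
      oracle-injective refl = refl
      display : Step searcher ∅ (cfg p₂ z z h g) (cfg (1 ℕ.+ p₂) ι z h g)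
      display = step-copy {searcher} (host j) result (code₀ here) refl (result-only z ι z h g)
      rest : Path searcher ∅ (Between c d) (cfg (1 ℕ.+ p₂) ι z h g) (cfg (3 ℕ.+ p₂) ι z h′ (λ _ → z))
      rest = singleton _ (after-call (line c) 1 , inj₁ (hosting (1 ℕ.+ p₂) ι z h g))
        -- Here the host registers change from those of `c` to those of `d`: the computed value and
        -- the oracle's answer are both the characteristic value of `x` at the query.
        ▷⟨ step-copy {searcher} (sub 0) (host j) (code₁ here) (trans (char-unique {x} char′ char) (sym g-value))
             (host-only ι z h h′ g j same) ⟩
          (after-call (line c) 2 , inj₂ (hosting (2 ℕ.+ p₂) ι z h′ g))
        ▷⟨ step-copy {searcher} zer (sub 0) (code₂ here) refl (sub0-only ι z h′ g g-suc) ⟩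
          (after-call (line c) 3 , inj₂ (hosting (3 ℕ.+ p₂) ι z h′ (λ _ → z)))

    searcher-halted : ∀ {c} → Halted P c → Halted searcher ⟦ c ⟧
    searcher-halted halted = ℕₚ.≤-reflexive
      (trans (length-compile 0 P) (trans (ℕₚ.+-identityʳ _) (sym (host-line-≥ halted))))

    transition : ∀ {x} → (∀ ι → ∃[ v ] IsChar x ι v × C ^ ∅ [ ι ∷ z ∷ [] ]↓= v) →
                 ∀ {c d} → Step P x c d → Transition searcher ∅ (Displays c) c d
    transition {x} computes {c} {d} step with step⇒at {P} step
    ... | cmd , at , exec = by-command cmd at exec
      where
      by-command : ∀ cmd → At P (line c) cmd → Exec x cmd c d → Transition searcher ∅ (Displays c) c d
      called₀ : ∀ cmd (at : At P (line c) cmd) → Called searcher ∅ c d (proj₁ (computes (reg c (queried cmd))))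
      called₀ cmd at = called {searcher} {c} (queried cmd) (tail cmd) (code {c} {d} at)
        (proj₂ (proj₂ (computes (reg c (queried cmd)))))
      code₀ : ∀ cmd (at : At P (line c) cmd) → Code searcher (call-length ℕ.+ host-line (line c)) (tail cmd)
      code₀ cmd at = code-after-call {searcher} {c} (queried cmd) (tail cmd) (code {c} {d} at)
      by-command cmd@(increment _)     at exec = plain-transition at (called₀ cmd at) (code₀ cmd at) (λ _ ()) exec
      by-command cmd@(copy _ _)        at exec = plain-transition at (called₀ cmd at) (code₀ cmd at) (λ _ ()) exec
      by-command cmd@(jump-if-≡ _ _ _) at exec = plain-transition at (called₀ cmd at) (code₀ cmd at) (λ _ ()) exec
      by-command cmd@(oracle j)        at exec =
        oracle-transition {x} at (proj₁ (proj₂ (computes (reg c j)))) (called₀ cmd at) exec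

-- The recognizer built from a search

module RecognizerProgram {ℓ : Level} (em : ExcludedMiddle ℓ) (α : Ordinal ℓ)
  {z : Ordinal.Carrier α} (z-zero : Ordinal.IsZero α z)
  (C P : Program) where
  open Ordinal α hiding (_<_; _≤_; wellFounded)
  open Machine α
  open Runs em α
  open Paths em α
  open Slots em α z-zero
  open Simulation em α z-zero
  open Programs em α z-zero
  open Subroutine C
  open Compiled C P 7

  -- The line just past the final increment. Jumping there halts with `result` still 0, whereas a
  -- search that runs to its end falls into the increment and halts at the same line with output 1.
  failure : ℕ
  failure = suc (length P ℕ.* L)

  tail : ℕ → Command → List Command
  tail p cmd =
    -- The query is made on a copy because the oracle overwrites its argument. The tail starts at
    -- `p`, so on agreement `4 ℕ.+ p` skips the unconditional exit at `3 ℕ.+ p`.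
    copy ⌜ host 0 ⌝ ⌜ probe ⌝ ∷ oracle ⌜ probe ⌝ ∷ jump-if-≡ ⌜ sub 0 ⌝ ⌜ probe ⌝ (4 ℕ.+ p) ∷
    jump-if-≡ ⌜ zer ⌝ ⌜ zer ⌝ failure ∷
    copy ⌜ zer ⌝ ⌜ probe ⌝ ∷ copy ⌜ zer ⌝ ⌜ sub 0 ⌝ ∷ translate host host-line cmd ∷ []

  block : ℕ → Command → List Command
  block p cmd = call 0 p ++ tail (call-length ℕ.+ p) cmd

  length-block : ∀ p cmd → length (block p cmd) ≡ L
  length-block p cmd = trans (length-++ (call 0 p))
    (trans (cong (ℕ._+ 7) (length-call 0 p)) (ℕₚ.+-comm call-length 7))

  epilogue : List Command
  epilogue = increment ⌜ result ⌝ ∷ []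

  open Blocks block L length-block epilogue

  recognizer : Program
  recognizer = compile P

  host-line≤failure : ∀ l → host-line l ℕ.≤ failure
  host-line≤failure l = ℕₚ.m≤n⇒m≤1+n (ℕₚ.*-monoˡ-≤ L (ℕₚ.m⊓n≤n l (length P)))

  failure-halted : length recognizer ℕ.≤ failure
  failure-halted = ℕₚ.≤-reflexive (trans (length-compile 0 P) (ℕₚ.+-comm (length P ℕ.* L) 1))

  module _ {c d : Config} {cmd : Command} (at : At P (line c) cmd) {y v w}
    (output : C ^ ∅ [ reg c 0 ∷ z ∷ [] ]↓= v) (char : IsChar y (reg c 0) w) where
    private
      p₂ = call-length ℕ.+ host-line (line c)
      h  = reg c

      code : Code recognizer (host-line (line c)) (block (host-line (line c)) cmd)
      code = subst (λ p → Code recognizer p (block p cmd)) (sym (host-line-≤ (ℕₚ.<⇒≤ (at-< at)))) (code-block at)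

      open Called (called {recognizer} {c} 0 (tail p₂ cmd) code {y} {d} output)

      code₀ = code-after-call {recognizer} {c} 0 (tail p₂ cmd) code
      code₁ = code-tail {recognizer} code₀
      code₂ = code-tail {recognizer} code₁
      code₃ = code-tail {recognizer} code₂
      code₄ = code-tail {recognizer} code₃
      code₅ = code-tail {recognizer} code₄
      code₆ = code-tail {recognizer} code₅

      probed : Path recognizer y (Between c d) ⟦ c ⟧ (cfg (2 ℕ.+ p₂) z w h g)
      probed = path
        ▷⟨ step-copy {recognizer} (host 0) probe (code₀ here) refl (probe-only z z (h 0) h g) ⟩
          (after-call (line c) 1 , inj₁ (hosting (1 ℕ.+ p₂) z (h 0) h g))
        ▷⟨ step-oracle {recognizer} probe (code₁ here) char (probe-only z (h 0) w h g) ⟩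
          (after-call (line c) 2 , inj₁ (hosting (2 ℕ.+ p₂) z w h g))

    match-transition : Exec ∅ cmd c d → v ≡ w → Transition recognizer y U c d
    match-transition exec v≡w = record
      { path  = probed
          ▷⟨ step-jump {recognizer} {n = 2 ℕ.+ p₂} {slots z w h g} {slots z w h g} (sub 0) probe
               (code₂ here) (inj₁ (trans g-value v≡w , refl)) (λ _ → refl) ⟩
            (after-call (line c) 4 , inj₁ (hosting (4 ℕ.+ p₂) z w h g))
          ▷⟨ step-copy {recognizer} zer probe (code₄ here) refl (probe-only z w z h g) ⟩
            (after-call (line c) 5 , inj₁ (hosting (5 ℕ.+ p₂) z z h g))
          ▷⟨ step-copy {recognizer} zer (sub 0) (code₅ here) refl (sub0-only z z h g g-suc) ⟩
            (after-call (line c) 6 , inj₁ (hosting (6 ℕ.+ p₂) z z h (λ _ → z)))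
      ; step  = Translate.translate-step host-injective host? host-line (host-next (at-< at))
                  refl (λ _ → refl) (λ _ → refl) (hosts-only z z h (reg d) (λ _ → z)) cmd (code₆ here) exec
      ; visit = (one , one , one , Path.first probed) , tt
      }

    mismatch-path : v ≢ w → Path recognizer y (Between c d) ⟦ c ⟧ (cfg failure z w h g)
    mismatch-path v≢w = probed
      ▷⟨ step-jump {recognizer} {n = 2 ℕ.+ p₂} {slots z w h g} {slots z w h g} (sub 0) probe
           (code₂ here) (inj₂ ((λ g0≡w → v≢w (trans (sym g-value) g0≡w)) , refl)) (λ _ → refl) ⟩
          (after-call (line c) 3 , inj₁ (hosting (3 ℕ.+ p₂) z w h g))
      ▷⟨ step-jump {recognizer} {n = 3 ℕ.+ p₂} {slots z w h g} {slots z w h g} zer zer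
           (code₃ here) (inj₁ (refl , refl)) (λ _ → refl) ⟩
          (host-line≤failure (line c) , inj₁ (hosting failure z w h g))

  success-path : ∀ {y c d o} → Halted P c → IsSuc z o →
                 Path recognizer y (Between c d) ⟦ c ⟧ (cfg failure o z (reg c) (λ _ → z))
  success-path {y} {c} {d} {o} halted suc-z = subst
    (λ n → Path recognizer y (Between c d) (cfg n z z (reg c) (λ _ → z)) (cfg failure o z (reg c) (λ _ → z)))
    (sym n≡)
    (singleton _ (ℕₚ.≤-reflexive n≡ , inj₁ (hosting (length P ℕ.* L) z z (reg c) (λ _ → z)))
      ▷⟨ step-increment {recognizer} result (at-epilogue 0 P here) suc-z (result-only z o z (reg c) (λ _ → z)) ⟩
        (host-line≤failure (line c) , inj₁ (hosting failure o z (reg c) (λ _ → z))))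
    where
    n≡ : host-line (line c) ≡ length P ℕ.* L
    n≡ = host-line-≥ halted

-- The implications between the four statements

module Equivalences {ℓ : Level} (em : ExcludedMiddle ℓ) (α : Ordinal ℓ)
  {z : Ordinal.Carrier α} (z-zero : Ordinal.IsZero α z)
  {o : Ordinal.Carrier α} (suc-z : Ordinal.IsSuc α z o) where
  open Ordinal α hiding (_<_; _≤_; wellFounded)
  open Machine α
  open Runs em α
  open Paths em α
  open Slots em α z-zero
  open Simulation em α z-zero
  open Programs em α z-zero
  private
    module αₚ = OrdinalProperties α

  o-one : IsOne o
  o-one = z , z-zero , suc-z

  char : ∀ y ι → ∃[ v ] IsChar y ι v
  char y ι with em {y ι}
  ... | yes ι∈y = o , inj₁ (ι∈y , o-one)
  ... | no ι∉y  = z , inj₂ (ι∉y , z-zero)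

  char-transfer : ∀ {x y ι v} → IsChar x ι v → IsChar y ι v → ι ∈ x → ι ∈ y
  char-transfer (inj₁ _)         (inj₁ (ι∈y , _)) _   = ι∈y
  char-transfer (inj₂ (ι∉x , _)) _                ι∈x = contradiction ι∈x ι∉x
  char-transfer (inj₁ (_ , v1))  (inj₂ (_ , v0))  _   = contradiction refl (αₚ.zero≢one v0 v1)

  char-cong : ∀ {x y ι v} → (ι ∈ x → ι ∈ y) → (ι ∈ y → ι ∈ x) → IsChar x ι v → IsChar y ι v
  char-cong to from (inj₁ (ι∈x , v1)) = inj₁ (to ι∈x , v1)
  char-cong to from (inj₂ (ι∉x , v0)) = inj₂ (ι∉x ∘ from , v0)

  computable-∅ : Computable ∅
  computable-∅ = P , λ ι z′ z′0 → z′ , inj₂ ((λ ()) , z′0) , run ι z′ z′0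
    where
    -- The parameter 0 is in register 1, so copying it to the output register computes the constant
    -- 0.
    P = copy 1 0 ∷ []
    run : ∀ ι z′ → IsZero z′ → P ^ ∅ [ ι ∷ z′ ∷ [] ]↓= z′
    run ι z′ z′0 = path⇒run refl (refl , refl , λ _ → z′0) (ℕ.s≤s ℕ.z≤n) path , refl
      where
      start stop : Config
      start = record { line = 0 ; reg = λ { zero → ι ; (suc _) → z′ } }
      stop  = record { line = 1 ; reg = λ _ → z′ }
      path : Path P ∅ U start stop
      path = singleton start tt
        ▷⟨ at⇒step {P} {∅} {start} {stop} here
             (refl , refl , λ { zero 0≢0 → contradiction refl 0≢0 ; (suc _) _ → refl }) ⟩ tt

  flip : Carrier → Subset → Subset
  flip ι x κ = (κ ≢ ι × κ ∈ x) ⊎ (κ ≡ ι × κ ∉ x)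

  flip-≭ : ∀ {ι x} → ¬ (flip ι x ≐ x)
  flip-≭ {ι} {x} (flip⊆x , x⊆flip) = ι∉x (flip⊆x (inj₂ (refl , ι∉x)))
    where
    ι∉x : ι ∉ x
    ι∉x ι∈x with x⊆flip ι∈x
    ... | inj₁ (ι≢ι , _) = ι≢ι refl
    ... | inj₂ (_ , ι∉x) = ι∉x ι∈x

  flip-char : ∀ {ι x κ v} → κ ≢ ι → IsChar x κ v → IsChar (flip ι x) κ v
  flip-char {ι} {x} {κ} κ≢ι = char-cong {x} {flip ι x} (λ κ∈x → inj₁ (κ≢ι , κ∈x)) λ where
    (inj₁ (_ , κ∈x)) → κ∈x
    (inj₂ (κ≡ι , _)) → contradiction κ≡ι κ≢ι

  module _ {P x ξs} (ρ : HaltingRun P x ξs) where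
    open RunProperties ρ using (_<_; conf; end; end-last; successor; module Time) renaming (IsSuc to IsSucᵀ)

    Queries : Carrier → Set ℓ
    Queries ι = ∃[ t ] t < end × ∃[ j ] At P (line (conf t)) (oracle j) × reg (conf t) j ≡ ι

    -- Only `successor` mentions the oracle, so clock, configurations and limits are kept, and the
    -- output is that of `ρ` by definition.
    flip-run : ∀ {ι} → ¬ Queries ι → HaltingRun P (flip ι x) ξs
    flip-run {ι} unqueried = record
      { HaltingRun ρ hiding (successor)
      ; successor = λ s t st → flip-step st (step⇒at {P} (successor s t st))
      }
      where
      flip-exec : ∀ {s t} cmd → IsSucᵀ s t → At P (line (conf s)) cmd → Exec x cmd (conf s) (conf t) →
                  Exec (flip ι x) cmd (conf s) (conf t)
      flip-exec (increment _)     _  _  exec = exec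
      flip-exec (copy _ _)        _  _  exec = exec
      flip-exec (jump-if-≡ _ _ _) _  _  exec = exec
      flip-exec {s} (oracle j) (s<t , _) at (eq , v , same) =
        eq , flip-char {ι} {x} (λ ≡ι → unqueried (s , Time.<-≤-trans s<t (end-last _) , j , at , ≡ι)) v , same
      flip-step : ∀ {s t} → IsSucᵀ s t → ∃[ cmd ] At P (line (conf s)) cmd × Exec x cmd (conf s) (conf t) →
                  Step P (flip ι x) (conf s) (conf t)
      flip-step st (cmd , at , exec) = at⇒step {P} at (flip-exec cmd st at exec)

  -- Flipping the oracle at an element that is never queried would not change
  -- the run, hence not the verdict.
  recognizer-queries : ∀ {x P} → (∀ y → ¬ (y ≐ x) → ∃[ v ] IsZero v × P ^ y [ z ∷ [] ]↓= v) →
                       (ρ : HaltingRun P x (z ∷ [])) → IsOne (HaltingRun.output ρ) → ∀ ι → Queries ρ ι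
  recognizer-queries {x} {P} rejects ρ accepted ι with em {Queries ρ ι}
  ... | yes queried   = queried
  ... | no unqueried with rejects (flip ι x) (flip-≭ {ι} {x})
  ...   | v , v0 , ρ′ , output≡v = contradiction
    (trans (sym output≡v) (output-unique ρ′ (flip-run ρ unqueried)))
    (αₚ.zero≢one v0 accepted)

  search : (∃[ x ] Computable x × Recognizable x) → Searchable
  search (x , (C , computes) , P , recognizes) = searcher , run
    where
    open SearchProgram C P
    open Compiled C P 4
    recognized : ∃[ v ] IsOne v × P ^ x [ z ∷ [] ]↓= v
    recognized = proj₁ (recognizes x z z-zero) ((λ p → p) , (λ p → p))
    ρ = proj₁ (proj₂ (proj₂ recognized))
    module ρ = RunProperties ρ
    open Prefix ρ
    host-path = prefix ρ.end
    module H = Path host-path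
    open Simulate host-path (λ t → Displays (H.conf t))
      (λ s t st → transition {x} (λ ι → computes ι z z-zero) (H.successor s t st))
      (singleton _ (ℕₚ.≤-refl , inj₁ (hosting 0 z z (reg (ρ.conf ρ.end)) (λ _ → z))))

    accepted : IsOne (HaltingRun.output ρ)
    accepted = subst IsOne (sym (proj₂ (proj₂ (proj₂ recognized)))) (proj₁ (proj₂ recognized))

    searching : HaltingRun searcher ∅ (z ∷ [])
    searching = path⇒run
      (initial-line-⟦⟧ {ρ.conf first} (ρ.initial-line first first-zero))
      (initial-regs-⟦⟧ {ρ.conf first} (ρ.initial-regs first first-zero))
      (searcher-halted {ρ.conf ρ.end} ρ.end-halted)
      simulation

    run : ∀ z′ → IsZero z′ → Σ[ ρ ∈ HaltingRun searcher ∅ (z′ ∷ []) ]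
      let open HaltingRun ρ in ∀ ι → ∃[ t ] Ordinal._<_ time t end × reg (conf t) 0 ≡ ι
    run z′ z′0 with refl ← ≡z z′0 = searching , λ ι →
      let t , t<end , j , at , t≡ι = recognizer-queries {x} {P} (λ y → proj₂ (recognizes y z z-zero)) ρ accepted ι
          τ , τ<last , displays = simulation-visit (Truncation.below t (ρ.end-last t)) t<end
      in τ , τ<last , trans (displays j at) t≡ι

  recognize : Searchable → ∀ x → Computable x → Recognizable x
  recognize (P , searches) x (C , computes) = recognizer , verdict
    where
    open RecognizerProgram em α z-zero C P
    open Compiled C P 7
    ρ = proj₁ (searches z z-zero)
    module ρ = RunProperties ρ
    open Prefix ρ

    χ : Carrier → Carrier
    χ ι = proj₁ (computes ι z z-zero)
    χ-char : ∀ ι → IsChar x ι (χ ι)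
    χ-char ι = proj₁ (proj₂ (computes ι z z-zero))
    χ-run : ∀ ι → C ^ ∅ [ ι ∷ z ∷ [] ]↓= χ ι
    χ-run ι = proj₂ (proj₂ (computes ι z z-zero))

    module _ (y : Subset) where

      χ′ : Carrier → Carrier
      χ′ ι = proj₁ (char y ι)

      -- Serves both verdicts: `e` is the end of the search when accepting and the first mismatch
      -- when rejecting, and `final` delivers the output.
      simulate : ∀ e → (∀ s → s ρ.< e → χ (reg (ρ.conf s) 0) ≡ χ′ (reg (ρ.conf s) 0)) →
                 ∀ {c} → Path recognizer y (Between (ρ.conf e) (ρ.conf e)) ⟦ ρ.conf e ⟧ c → line c ≡ failure →
                 recognizer ^ y [ z ∷ [] ]↓= reg c 0
      simulate e agree {c} final at-end = path⇒run
        (initial-line-⟦⟧ {ρ.conf first} (ρ.initial-line first first-zero))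
        (initial-regs-⟦⟧ {ρ.conf first} (ρ.initial-regs first first-zero))
        (subst (length recognizer ℕ.≤_) (sym at-end) failure-halted) simulation ,
        cong (λ c → reg c 0) (Path.conf-last simulation)
        where
        module T = Truncation ρ.time e
        module H = Path (prefix e)
        transition : ∀ s t → H.IsSuc s t → Transition recognizer y U (H.conf s) (H.conf t)
        transition s t st with step⇒at {P} (H.successor s t st)
        ... | cmd , at , exec = match-transition at (χ-run _) (proj₂ (char y _)) exec
          (agree (T.value s) (ρ.Time.<-≤-trans (proj₁ st) (T.≤e t)))
        open Simulate (prefix e) (λ _ → U) transition final

      agree⇒≐ : (∀ ι → χ ι ≡ χ′ ι) → y ≐ x
      agree⇒≐ agree =
        (λ {ι} → char-transfer {y} {x} (subst (IsChar y ι) (sym (agree ι)) (proj₂ (char y ι))) (χ-char ι)) ,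
        (λ {ι} → char-transfer {x} {y} (χ-char ι) (subst (IsChar y ι) (sym (agree ι)) (proj₂ (char y ι))))

      accept : y ≐ x → ∃[ v ] IsOne v × recognizer ^ y [ z ∷ [] ]↓= v
      accept (y⊆x , x⊆y) = o , o-one , simulate ρ.end
        (λ s _ → char-unique {y} (char-cong {x} {y} x⊆y y⊆x (χ-char _)) (proj₂ (char y _)))
        (success-path {c = ρ.conf ρ.end} {ρ.conf ρ.end} ρ.end-halted suc-z) refl

      reject : ¬ (y ≐ x) → ∃[ v ] IsZero v × recognizer ^ y [ z ∷ [] ]↓= v
      reject y≭x with em {∃[ ι ] χ ι ≢ χ′ ι}
      ... | no ∄ = contradiction (agree⇒≐ λ ι → decidable-stable (χ ι ≟ χ′ ι) λ χ≢χ′ → ∄ (ι , χ≢χ′)) y≭x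
        where open IsStrictTotalOrder isStrictTotalOrder using (_≟_)
      ... | yes (ι , χ≢χ′) with proj₂ (searches z z-zero) ι
      -- The search shows `ι` before it ends, but other mismatches may appear earlier. The
      -- recognizer leaves at the least such time.
      ...   | t , t<end , refl with ρ.Timeᶜ.least (λ s → χ (reg (ρ.conf s) 0) ≢ χ′ (reg (ρ.conf s) 0)) (t , χ≢χ′)
      ...     | e , χ≢χ′ᵉ , e-least =
        -- Since `e` lies before the end of the search, a command is active there, and its block
        -- contains the exit.
        let e⁺ , _ , step = ρ.step-before-end (ρ.Time.≤-<-trans (e-least t χ≢χ′) t<end)
            cmd , at , _ = step⇒at {P} step
        in z , z-zero , simulate e
          (λ s s<e → decidable-stable (_ ≟ _) λ χ≢χ′ˢ → ρ.Time.≤⇒≯ (e-least s χ≢χ′ˢ) s<e)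
          (mismatch-path {d = ρ.conf e} at (χ-run _) (proj₂ (char y _)) χ≢χ′ᵉ) refl
        where open IsStrictTotalOrder isStrictTotalOrder using (_≟_)

    verdict : ∀ y z′ → IsZero z′ →
      (y ≐ x → ∃[ v ] IsOne v × recognizer ^ y [ z′ ∷ [] ]↓= v) ×
      (¬ (y ≐ x) → ∃[ v ] IsZero v × recognizer ^ y [ z′ ∷ [] ]↓= v)
    verdict y z′ z′0 with refl ← ≡z z′0 = accept y , reject y

-- Infinity supplies an element other than the least one: an injection cannot send both 0 and 1 to
-- it.
one-exists : ∀ {ℓ} → ExcludedMiddle ℓ → (α : Ordinal ℓ) → ℕ ↣ Ordinal.Carrier α →
             ∃[ z ] ∃[ o ] Ordinal.IsZero α z × Ordinal.IsSuc α z o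
one-exists em α f with zero-exists (to 0)
  where open OrdinalProperties.Classical α em
        open Injection f using (to)
... | z , z0 = z , proj₁ successor , z0 , proj₁ (proj₂ successor)
  where
  open Ordinal α using (_<_; IsSuc; _≤_)
  open OrdinalProperties.Classical α em
  open Injection f using (to; injective)
  above : ∃[ a ] z < a
  above with z0 (to 0) | z0 (to 1)
  ... | inj₁ z<f0 | _         = to 0 , z<f0
  ... | inj₂ _    | inj₁ z<f1 = to 1 , z<f1
  ... | inj₂ z≡f0 | inj₂ z≡f1 with () ← injective (trans (sym z≡f0) z≡f1)
  successor : ∃[ o ] IsSuc z o × o ≤ proj₁ above
  successor = suc-exists (proj₂ above)

corollary6 : ∀ {ℓ : Level} → ExcludedMiddle (lsuc ℓ) →
    (α : Ordinal ℓ) → ExponentiallyClosed α →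
    let open Machine α in
    ((∀ x → Computable x → Recognizable x) ⇔ Recognizable ∅) ×
    (Recognizable ∅ ⇔ (∃[ x ] Computable x × Recognizable x)) ×
    ((∃[ x ] Computable x × Recognizable x) ⇔ Searchable)
corollary6 {ℓ} em′ α (ℕ↣α , _) =
  -- Recognizability passes from one set to another only through `Searchable`.
  mk⇔ (λ all → all ∅ computable-∅) (λ r∅ → recognize (search (∅ , computable-∅ , r∅))) ,
  mk⇔ (λ r∅ → ∅ , computable-∅ , r∅) (λ some → recognize (search some) ∅ computable-∅) ,
  mk⇔ search (λ searchable → ∅ , computable-∅ , recognize searchable ∅ computable-∅)
  where
  em : ExcludedMiddle ℓ
  em = map′ lower lift em′
  z-o = one-exists em α ℕ↣α
  open Equivalences em α (proj₁ (proj₂ (proj₂ z-o))) (proj₂ (proj₂ (proj₂ z-o)))
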